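{- Let $n\ge 3$. If $n$ is even, the only RSK-complete cycle type of permutations of $\{1,\dots,n\}$ is $(n)$. If $n$ is odd, the RSK-complete cycle types of permutations of $\{1,\dots,n\}$ are exactly $(n)$ and $(n-1,1)$.
   Context: A cycle type (cycle decomposition) is a partition $\mu=(n_1\ge n_2\ge\dots\ge n_k)$ of $n$ listing the cycle lengths of a permutation, fixed points counted as cycles of length $1$. For a permutation $\sigma=(\sigma_1,\dots,\sigma_n)$ of $\{1,\dots,n\}$, $P(\sigma)$ is its Robinson--Schensted--Knuth insertion tableau (insert $\sigma_1,\sigma_2,\dots$ in order by Schensted row insertion: to insert $a$ into row $r$, if row $r$ is empty or $a$ exceeds all its entries append $a$ and stop, otherwise replace the leftmost entry $b>a$ by $a$ and insert $b$ into row $r+1$), and $\Gamma(P(\sigma))$ is its shape (row lengths, nonincreasing). A cycle type $\mu$ of $n$ is RSK-complete if for every partition $\lambda$ of $n$ other than $(n)$ and $(1,1,\dots,1)$ there is a permutation $\sigma$ of $\{1,\dots,n\}$ with cycle type $\mu$ and $\Gamma(P(\sigma))=\lambda$. -}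

module Defs where

open import Data.Nat using (ℕ; zero; suc; _+_; _∸_; _≤_; _<_; _≤ᵇ_; _<ᵇ_)
open import Data.Bool using (Bool; true; false; if_then_else_; _∧_)
open import Data.Fin using (Fin; toℕ; _≟_)
open import Data.Fin.Permutation using (Permutation′; _⟨$⟩ʳ_)
open import Data.List using (List; []; _∷_; map; foldl; length; replicate; allFin; filter)
open import Data.Nat.ListAction using (sum)
open import Data.List.Relation.Unary.All using (All)
open import Data.List.Relation.Unary.Linked using (Linked)
open import Data.List.Relation.Binary.Permutation.Propositional using (_↭_)
open import Data.Maybe using (Maybe; just; nothing)
open import Data.Product using (Σ; _×_; _,_)
open import Relation.Binary.PropositionalEquality using (_≡_; _≢_)
open import Relation.Nullary.Decidable using (does; ⌊_⌋)
open import Data.Nat using (_≥_)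

IsPartition : ℕ → List ℕ → Set
IsPartition n μ = Linked _≥_ μ × All (λ k → 0 < k) μ × sum μ ≡ n

module _ {n : ℕ} (σ : Permutation′ n) where

  app : Fin n → Fin n
  app i = σ ⟨$⟩ʳ i

  iter : ℕ → Fin n → Fin n
  iter zero    x = x
  iter (suc k) x = iter k (app x)

  -- length of the cycle containing i: least k ≥ 1 with σ^k i = i
  -- (searched among 1..n, which always suffices)
  orbitLength : Fin n → ℕ
  orbitLength i = go n (app i) 1
    where
    go : ℕ → Fin n → ℕ → ℕ
    go zero    _ k = k
    go (suc f) x k = if does (x ≟ i) then k else go f (app x) (suc k)

  isCycleLeader : Fin n → Bool
  isCycleLeader i = go n
    where
    go : ℕ → Bool
    go zero    = true
    go (suc j) = (toℕ i ≤ᵇ toℕ (iter j i)) ∧ go j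

  cycleLengths : List ℕ
  cycleLengths = map orbitLength (filter (λ i → isCycleLeader i Data.Bool.≟ true) (allFin n))

  HasCycleType : List ℕ → Set
  HasCycleType μ = cycleLengths ↭ μ

rowInsert : ℕ → List ℕ → List ℕ × Maybe ℕ
rowInsert a []       = (a ∷ [] , nothing)
rowInsert a (b ∷ bs) with a <ᵇ b
... | true  = (a ∷ bs , just b)
... | false with rowInsert a bs
...   | (bs' , m) = (b ∷ bs' , m)

-- Schensted insertion of a into a tableau (list of rows, top row first)
insertTableau : ℕ → List (List ℕ) → List (List ℕ)
insertTableau a []       = (a ∷ []) ∷ []
insertTableau a (r ∷ rs) with rowInsert a r
... | (r' , nothing) = r' ∷ rs
... | (r' , just b)  = r' ∷ insertTableau b rs

P : List ℕ → List (List ℕ)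
P w = foldl (λ t a → insertTableau a t) [] w

Γ : List (List ℕ) → List ℕ
Γ t = map length t

oneLine : {n : ℕ} → Permutation′ n → List ℕ
oneLine {n} σ = map (λ i → suc (toℕ (σ ⟨$⟩ʳ i))) (allFin n)

RSKComplete : ℕ → List ℕ → Set
RSKComplete n μ =
  (λ' : List ℕ) → IsPartition n λ' → λ' ≢ n ∷ [] → λ' ≢ replicate n 1 →
  Σ (Permutation′ n) (λ σ → HasCycleType σ μ × Γ (P (oneLine σ)) ≡ λ')

{-# OPTIONS --safe #-}
module Submission where

-- Excluded types. A permutation of shape (n − 1, 1) has a point p such that all other
-- points move weakly down, or all move weakly up; every nontrivial cycle then contains p,
-- so there is at most one. A permutation with a two-row shape (p, q) avoids 321, so a
-- fixed point f has only smaller letters before it and larger ones after it; f is never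
-- bumped, and deleting all fixed points shortens only the first row. Hence there are at
-- most p − q of them, which for (⌈n/2⌉, ⌊n/2⌋) is the parity of n.
--
-- Realised shapes. A shape is built column by column. If w = u x is a cyclic word of
-- length M, the word u (M+c) … x … (M+1), whose last c + 1 letters are the new ones in
-- decreasing order interrupted by x, has the shape of w with a column of length c added:
-- the first rows of P(w) get one large entry each. With x in the middle of the block the
-- new positions form a zigzag M, M+c, M+1, M+c−1, … ending in x, so the word stays cyclic;
-- one place earlier, and an odd column keeps a fixed point. Columns of length 1 are
-- added by appending n to a word whose largest letter, enlarged to n + 1, is not in the
-- first row. The construction starts from a word with two columns, made of two such
-- zigzags. A fixed point can also be appended at the end when the first row is longer
-- than the second, which leaves the shape (2, 1, …, 1) to an explicit word.

open import Defs
open import Data.Bool using (Bool; true; false; T; if_then_else_; _∧_; not; _xor_)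
open import Data.Bool.Properties using (not-involutive)
open import Data.Empty using (⊥; ⊥-elim)
import Data.Fin as Fin
open import Data.Fin using (Fin; zero; suc; toℕ; fromℕ<; punchIn; punchOut)
open import Data.Fin.Permutation using (Permutation′; inverseˡ; permutation)
open import Data.Fin.Properties using (toℕ-injective; toℕ<n; toℕ-fromℕ<; pigeonhole; injective⇒≤; any?; punchIn-injective; punchOut-injective; punchInᵢ≢i)
open import Data.List using (List; []; _∷_; _++_; length; map; filter; foldl; allFin; tabulate; replicate; _ʳ++_; initLast; _∷ʳ′_; lookup; foldr)
open import Data.List.Membership.Propositional using (_∈_)
open import Data.List.Membership.Propositional.Properties using (∈-allFin; ∈-tabulate⁻; ∈-filter⁻; ∈-tabulate⁺; ∈-lookup)
open import Data.List.Properties using (map-id; filter-accept; filter-reject; filter-none; ++-assoc; ++-identityʳ; ∷-injectiveˡ; ∷-injectiveʳ; map-tabulate; length-replicate; length-++; length-ʳ++; foldl-++; tabulate-cong; tabulate-lookup; length-map)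
import Data.List.Relation.Binary.Permutation.Propositional as Perm
open import Data.List.Relation.Binary.Permutation.Propositional using (_↭_; ↭-reflexive; ↭-sym; ↭-trans)
open import Data.List.Relation.Binary.Permutation.Propositional.Properties using (filter-↭; ↭-length; ++-comm; shift; All-resp-↭)
open import Data.List.Relation.Binary.Sublist.Propositional using (_⊆_; []; _∷_; _∷ʳ_; minimum)
import Data.List.Relation.Unary.All as All
open import Data.List.Relation.Unary.All using (All; []; _∷_)
import Data.List.Relation.Unary.All.Properties as All
open import Data.List.Relation.Unary.AllPairs using (AllPairs; []; _∷_)
import Data.List.Relation.Unary.AllPairs.Properties as AllPairs
open import Data.List.Relation.Unary.Any using (here; there)
open import Data.List.Relation.Unary.Linked using (Linked; []; [-]; _∷_) renaming (tail to Linked-tail)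
open import Data.List.Relation.Unary.Unique.Propositional using (Unique)
open import Data.List.Relation.Unary.Unique.Propositional.Properties using (allFin⁺) renaming (filter⁺ to unique-filter⁺)
open import Data.Maybe using (Maybe; just; nothing; maybe)
open import Data.Nat using (ℕ; zero; suc; _+_; _*_; _∸_; _≤_; _<_; _≥_; _≤ᵇ_; _<ᵇ_; _%_; _/_; z≤n; s≤s; z<s; NonZero; >-nonZero; _≟_)
open import Data.Nat.DivMod using (m≡m%n+[m/n]*n; m%n<n; m≥n⇒m/n>0)
open import Data.Nat.ListAction using (sum)
open import Data.Nat.Properties hiding (_≟_)
open import Data.Nat.Tactic.RingSolver using (solve-∀)
open import Data.Product using (∃; ∃₂; _×_; _,_; proj₁; proj₂)
open import Data.Sum using (_⊎_; inj₁; inj₂)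
open import Function using (case_of_; _∘_; id)
open import Function.Bundles using (_⇔_; mk⇔)
open import Level using (0ℓ)
open import Relation.Binary using (tri<; tri≈; tri>)
import Relation.Binary.Construct.Closure.Transitive as Closure
open import Relation.Binary.Construct.Closure.Transitive using (TransClosure; [_]; _∷_)
open import Relation.Binary.PropositionalEquality using (_≡_; _≢_; refl; sym; trans; cong; cong₂; subst; subst₂; module ≡-Reasoning)
open import Relation.Nullary using (¬_; yes; no; does; contradiction)
open import Relation.Nullary.Decidable using (¬?; _×-dec_)
open import Relation.Unary using (Pred; Decidable)

-- Named copies of the local searches of orbitLength and isCycleLeader

module _ {n : ℕ} (σ : Permutation′ n) (i : Fin n) where

  firstReturn : ℕ → Fin n → ℕ → ℕ
  firstReturn zero    x k = k
  firstReturn (suc f) x k = if does (x Fin.≟ i) then k else firstReturn f (app σ x) (suc k)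

  minimalBelow : ℕ → Bool
  minimalBelow zero    = true
  minimalBelow (suc j) = (toℕ i ≤ᵇ toℕ (iter σ j i)) ∧ minimalBelow j

-- The left-hand side of the first signature is the local function of
-- orbitLength, which has no name here: unification finds it in the last
-- clause of orbitLength≡, where size and fuel are abstracted separately.
mutual
  search≡firstReturn : ∀ {w} (σ : Permutation′ w) (i : Fin w) f x k → _ ≡ firstReturn σ i f x k

  orbitLength≡ : ∀ {n} (σ : Permutation′ n) i → orbitLength σ i ≡ firstReturn σ i n (app σ i) 1
  orbitLength≡ {suc m} σ i with does (app σ i Fin.≟ i)
  ... | true  = refl
  ... | false with suc m | σ | i | app σ (app σ i) | 2
  ...   | w | τ | j | x | k = search≡firstReturn τ j m x k

  search≡firstReturn σ i zero    x k = refl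
  search≡firstReturn σ i (suc f) x k with does (x Fin.≟ i)
  ... | true  = refl
  ... | false = search≡firstReturn σ i f (app σ x) (suc k)

mutual
  search≡minimalBelow : ∀ {w} (σ : Permutation′ w) (i : Fin w) f → _ ≡ minimalBelow σ i f

  isCycleLeader≡ : ∀ {n} (σ : Permutation′ n) i → isCycleLeader σ i ≡ minimalBelow σ i n
  isCycleLeader≡ {suc m} σ i with toℕ i ≤ᵇ toℕ (iter σ m i)
  ... | false = refl
  ... | true with suc m | σ | i
  ...   | w | τ | j = search≡minimalBelow τ j m

  search≡minimalBelow σ i zero    = refl
  search≡minimalBelow σ i (suc f) = cong ((toℕ i ≤ᵇ toℕ (iter σ f i)) ∧_) (search≡minimalBelow σ i f)

-- Iterates and orbits of a permutation

module Orbit {n : ℕ} (σ : Permutation′ n) where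

  app-injective : ∀ {x y} → app σ x ≡ app σ y → x ≡ y
  app-injective eq = trans (sym (inverseˡ σ)) (trans (cong (Data.Fin.Permutation._⟨$⟩ˡ_ σ) eq) (inverseˡ σ))

  iter-+ : ∀ a b x → iter σ (a + b) x ≡ iter σ b (iter σ a x)
  iter-+ zero    b x = refl
  iter-+ (suc a) b x = iter-+ a b (app σ x)

  iter-suc : ∀ k x → iter σ (suc k) x ≡ app σ (iter σ k x)
  iter-suc zero    x = refl
  iter-suc (suc k) x = iter-suc k (app σ x)

  iter-injective : ∀ k {x y} → iter σ k x ≡ iter σ k y → x ≡ y
  iter-injective zero    eq = eq
  iter-injective (suc k) eq = app-injective (iter-injective k eq)

  iter-cancel : ∀ a l x → iter σ (a + l) x ≡ iter σ a x → iter σ l x ≡ x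
  iter-cancel a l x eq = iter-injective a (trans (sym (iter-+ l a x)) (trans (cong (λ k → iter σ k x) (+-comm l a)) eq))

  iter-* : ∀ q l {x} → iter σ l x ≡ x → iter σ (q * l) x ≡ x
  iter-* zero    l eq = refl
  iter-* (suc q) l {x} eq = trans (iter-+ l (q * l) x) (trans (cong (iter σ (q * l)) eq) (iter-* q l eq))

  iter-% : ∀ k l .{{_ : NonZero l}} {x} → iter σ l x ≡ x → iter σ k x ≡ iter σ (k % l) x
  iter-% k l {x} eq = begin
    iter σ k x                              ≡⟨ cong (λ j → iter σ j x) (trans (m≡m%n+[m/n]*n k l) (+-comm (k % l) _)) ⟩
    iter σ (k / l * l + k % l) x            ≡⟨ iter-+ (k / l * l) (k % l) x ⟩
    iter σ (k % l) (iter σ (k / l * l) x)   ≡⟨ cong (iter σ (k % l)) (iter-* (k / l) l eq) ⟩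
    iter σ (k % l) x                        ∎
    where open ≡-Reasoning

  -- Two of the `n + 1` iterates numbered 0 to `n` coincide by the pigeonhole principle; cancelling
  -- the steps they share leaves a return time of at most `n`, the range searched by the
  -- definitions.
  period : ∀ x → ∃ λ l → 0 < l × l ≤ n × iter σ l x ≡ x
  period x with pigeonhole (n<1+n n) (λ j → iter σ (toℕ j) x)
  ... | i , j , i<j , eq = toℕ j ∸ toℕ i , m<n⇒0<n∸m i<j , ≤-trans (m∸n≤m (toℕ j) (toℕ i)) (≤-pred (toℕ<n j)) ,
    iter-cancel (toℕ i) _ x (trans (cong (λ k → iter σ k x) (m+[n∸m]≡n (<⇒≤ i<j))) (sym eq))

  iter-sym : ∀ k {x y} → iter σ k x ≡ y → ∃ λ j → iter σ j y ≡ x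
  iter-sym k {x} {y} eq with period x
  -- With period `suc l`, the `k` steps already made and `k * l` further ones add up to a multiple
  -- of the period.
  ... | suc l , _ , _ , ret = k * l , (begin
    iter σ (k * l) y               ≡⟨ cong (iter σ (k * l)) (sym eq) ⟩
    iter σ (k * l) (iter σ k x)    ≡⟨ sym (iter-+ k (k * l) x) ⟩
    iter σ (k + k * l) x           ≡⟨ cong (λ j → iter σ j x) (sym (*-suc k l)) ⟩
    iter σ (k * suc l) x           ≡⟨ iter-* k (suc l) ret ⟩
    x                              ∎)
    where open ≡-Reasoning

  -- A known return time `j` certifies that the fuel suffices: the search stands at step `k`, and
  -- `j` lies among the `f` steps it may still inspect.
  firstReturn-spec : ∀ i f k j → k ≤ j → j < k + f → iter σ j i ≡ i →
    let r = firstReturn σ i f (iter σ k i) k in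
    k ≤ r × iter σ r i ≡ i × (∀ m → k ≤ m → m < r → iter σ m i ≢ i)
  firstReturn-spec i zero    k j k≤j j<k eq = contradiction k≤j (<⇒≱ (subst (j <_) (+-identityʳ k) j<k))
  firstReturn-spec i (suc f) k j k≤j j<k eq with iter σ k i Fin.≟ i
  ... | yes p = ≤-refl , p , λ m k≤m m<k → contradiction k≤m (<⇒≱ m<k)
  ... | no ¬p with m≤n⇒m<n∨m≡n k≤j
  ...   | inj₂ refl = contradiction eq ¬p
  ...   | inj₁ k<j with firstReturn-spec i f (suc k) j k<j (subst (j <_) (+-suc k f) j<k) eq
  ...     | ih rewrite iter-suc k i with ih
  ...       | sk≤r , ret , least = <⇒≤ sk≤r , ret , least′
    where
    least′ : ∀ m → k ≤ m → _ → iter σ m i ≢ i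
    least′ m k≤m m<r with m≤n⇒m<n∨m≡n k≤m
    ... | inj₁ k<m  = least m k<m m<r
    ... | inj₂ refl = ¬p

  orbitLength-spec : ∀ i → 0 < orbitLength σ i × iter σ (orbitLength σ i) i ≡ i ×
    (∀ m → 0 < m → m < orbitLength σ i → iter σ m i ≢ i)
  orbitLength-spec i rewrite orbitLength≡ σ i with period i
  ... | l , 0<l , l≤n , ret = firstReturn-spec i n 1 l 0<l (s≤s l≤n) ret

  orbitLength-least : ∀ i l → 0 < l → iter σ l i ≡ i → orbitLength σ i ≤ l
  orbitLength-least i l 0<l ret with orbitLength σ i ≤? l
  ... | yes p = p
  ... | no ¬p = contradiction ret (proj₂ (proj₂ (orbitLength-spec i)) l 0<l (≰⇒> ¬p))

  orbitLength≤n : ∀ i → orbitLength σ i ≤ n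
  orbitLength≤n i with period i
  ... | l , 0<l , l≤n , ret = ≤-trans (orbitLength-least i l 0<l ret) l≤n

  orbitLength≡1⇒fixed : ∀ i → orbitLength σ i ≡ 1 → app σ i ≡ i
  orbitLength≡1⇒fixed i eq = subst (λ l → iter σ l i ≡ i) eq (proj₁ (proj₂ (orbitLength-spec i)))

  fixed⇒orbitLength≡1 : ∀ i → app σ i ≡ i → orbitLength σ i ≡ 1
  fixed⇒orbitLength≡1 i eq = ≤-antisym (orbitLength-least i 1 z<s eq) (proj₁ (orbitLength-spec i))

  iterates-distinct : ∀ i a b → a < b → b < orbitLength σ i → iter σ a i ≢ iter σ b i
  iterates-distinct i a b a<b b<l eq = proj₂ (proj₂ (orbitLength-spec i)) (b ∸ a) (m<n⇒0<n∸m a<b)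
    (≤-<-trans (m∸n≤m b a) b<l)
    (iter-cancel a (b ∸ a) i (trans (cong (λ k → iter σ k i) (m+[n∸m]≡n (<⇒≤ a<b))) (sym eq)))

  minimalBelow-sound : ∀ i f → minimalBelow σ i f ≡ true → ∀ j → j < f → toℕ i ≤ toℕ (iter σ j i)
  minimalBelow-sound i (suc f) eq j j<f with toℕ i ≤ᵇ toℕ (iter σ f i) in le
  ... | true with m≤n⇒m<n∨m≡n (≤-pred j<f)
  ...   | inj₁ j<f′ = minimalBelow-sound i f eq j j<f′
  ...   | inj₂ refl = ≤ᵇ⇒≤ _ _ (subst T (sym le) _)

  minimalBelow-complete : ∀ i f → (∀ j → toℕ i ≤ toℕ (iter σ j i)) → minimalBelow σ i f ≡ true
  minimalBelow-complete i zero    le = refl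
  minimalBelow-complete i (suc f) le with toℕ i ≤ᵇ toℕ (iter σ f i) | ≤⇒≤ᵇ (le f)
  ... | true | _ = minimalBelow-complete i f le

  -- The Boolean test inspects only the first `n` iterates; reducing an exponent modulo the period,
  -- which is at most `n`, extends the bound to all of them.
  leader-min : ∀ i → isCycleLeader σ i ≡ true → ∀ j → toℕ i ≤ toℕ (iter σ j i)
  leader-min i eq j with period i
  ... | suc l , _ , l≤n , ret = subst (λ x → toℕ i ≤ toℕ x) (sym (iter-% j (suc l) ret))
    (minimalBelow-sound i n (trans (sym (isCycleLeader≡ σ i)) eq) (j % suc l) (<-≤-trans (m%n<n j (suc l)) l≤n))

  min-leader : ∀ i → (∀ j → toℕ i ≤ toℕ (iter σ j i)) → isCycleLeader σ i ≡ true
  min-leader i le = trans (isCycleLeader≡ σ i) (minimalBelow-complete i n le)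

  -- An orbit returns, so it cannot be trapped in a set that misses its start.
  no-trap : ∀ {p} (S : Pred (Fin n) p) x → S (app σ x) → (∀ {y} → S y → S (app σ y)) → S x
  no-trap S x start closed with period x
  ... | suc l , _ , _ , ret = subst S ret (stays l start)
    where
    stays : ∀ k {y} → S y → S (iter σ k y)
    stays zero    s = s
    stays (suc k) s = stays k (closed s)

-- Counting with filters

filter-unique : ∀ {a p} {A : Set a} {P : Pred A p} (P? : Decidable P) {x : A} {xs} →
  Unique xs → x ∈ xs → P x → (∀ {y} → y ∈ xs → P y → y ≡ x) → filter P? xs ≡ x ∷ []
filter-unique P? {x} (x∉xs ∷ u) (here refl) px only =
  trans (filter-accept P? px) (cong (x ∷_) (filter-none P? (All.tabulate λ y∈xs py →
    All.lookup x∉xs y∈xs (sym (only (there y∈xs) py)))))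
filter-unique P? (y∉xs ∷ u) (there x∈xs) px only =
  trans (filter-reject P? λ py → All.lookup y∉xs x∈xs (only (here refl) py))
        (filter-unique P? u x∈xs px (only ∘ there))

length-filter-subsingleton : ∀ {a p} {A : Set a} {P : Pred A p} (P? : Decidable P) {xs} →
  Unique xs → (∀ {x y} → x ∈ xs → y ∈ xs → P x → P y → x ≡ y) → length (filter P? xs) ≤ 1
length-filter-subsingleton P? []           _    = z≤n
length-filter-subsingleton P? {x ∷ xs} (x∉xs ∷ u) same with P? x
... | no _   = length-filter-subsingleton P? u λ y∈ z∈ → same (there y∈) (there z∈)
... | yes px = s≤s (≤-reflexive (cong length (filter-none P? (All.tabulate λ y∈xs py →
    All.lookup x∉xs y∈xs (same (here refl) (there y∈xs) px py)))))

length-filter-mono : ∀ {a b p q} {A : Set a} {B : Set b} {P : Pred A p} {Q : Pred B q}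
  (P? : Decidable P) (Q? : Decidable Q) (f : A → B) → (∀ {x} → P x → Q (f x)) →
  ∀ xs → length (filter P? xs) ≤ length (filter Q? (map f xs))
length-filter-mono P? Q? f imp []       = z≤n
length-filter-mono P? Q? f imp (x ∷ xs) with P? x | Q? (f x)
... | yes _ | yes _ = s≤s (length-filter-mono P? Q? f imp xs)
... | yes p | no ¬q = contradiction (imp p) ¬q
... | no _  | yes _ = m≤n⇒m≤1+n (length-filter-mono P? Q? f imp xs)
... | no _  | no _  = length-filter-mono P? Q? f imp xs

length-filter-map : ∀ {a b q} {A : Set a} {B : Set b} {Q : Pred B q}
  (Q? : Decidable Q) (f : A → B) → ∀ xs → length (filter Q? (map f xs)) ≡ length (filter (Q? ∘ f) xs)
length-filter-map Q? f []       = refl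
length-filter-map Q? f (x ∷ xs) with does (Q? (f x))
... | true  = cong suc (length-filter-map Q? f xs)
... | false = length-filter-map Q? f xs

length-filter-filter : ∀ {a p q} {A : Set a} {P : Pred A p} {Q : Pred A q}
  (P? : Decidable P) (Q? : Decidable Q) → ∀ xs → length (filter P? (filter Q? xs)) ≤ length (filter P? xs)
length-filter-filter P? Q? []       = z≤n
length-filter-filter P? Q? (x ∷ xs) with does (Q? x)
... | false with does (P? x)
...   | true  = m≤n⇒m≤1+n (length-filter-filter P? Q? xs)
...   | false = length-filter-filter P? Q? xs
length-filter-filter P? Q? (x ∷ xs) | true with does (P? x)
...   | true  = s≤s (length-filter-filter P? Q? xs)
...   | false = length-filter-filter P? Q? xs

length-filter-partition : ∀ {a p} {A : Set a} {P : Pred A p} (P? : Decidable P) →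
  ∀ xs → length (filter (λ x → ¬? (P? x)) xs) + length (filter P? xs) ≡ length xs
length-filter-partition P? []       = refl
length-filter-partition P? (x ∷ xs) with does (P? x)
... | true  = trans (+-suc _ _) (cong suc (length-filter-partition P? xs))
... | false = cong suc (length-filter-partition P? xs)

-- Counting fixed points and nontrivial cycles

module CycleType {n : ℕ} (σ : Permutation′ n) where
  open Orbit σ

  leader? : Decidable (λ i → isCycleLeader σ i ≡ true)
  leader? i = isCycleLeader σ i Data.Bool.≟ true

  fixed? : Decidable (λ i → app σ i ≡ i)
  fixed? i = app σ i Fin.≟ i

  count-ones : length (filter (_≟ 1) (cycleLengths σ)) ≤ length (filter fixed? (allFin n))
  count-ones = begin
    length (filter (_≟ 1) (cycleLengths σ))
      ≡⟨ length-filter-map (_≟ 1) (orbitLength σ) (filter leader? (allFin n)) ⟩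
    length (filter ((_≟ 1) ∘ orbitLength σ) (filter leader? (allFin n)))
      ≤⟨ length-filter-filter ((_≟ 1) ∘ orbitLength σ) leader? (allFin n) ⟩
    length (filter ((_≟ 1) ∘ orbitLength σ) (allFin n))
      ≤⟨ length-filter-mono ((_≟ 1) ∘ orbitLength σ) fixed? id (orbitLength≡1⇒fixed _) (allFin n) ⟩
    length (filter fixed? (map id (allFin n)))
      ≡⟨ cong (length ∘ filter fixed?) (map-id (allFin n)) ⟩
    length (filter fixed? (allFin n)) ∎
    where open ≤-Reasoning

  -- Orbits are symmetric, so each of the two leaders reaches the other through `p`; both are
  -- minimal in their common orbit.
  same-orbit-leaders : ∀ {i j p} → isCycleLeader σ i ≡ true → isCycleLeader σ j ≡ true →
    (∃ λ k → iter σ k i ≡ p) → (∃ λ k → iter σ k j ≡ p) → i ≡ j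
  same-orbit-leaders {i} {j} li lj (k , ik) (l , jl) = toℕ-injective (≤-antisym (below k l li ik jl) (below l k lj jl ik))
    where
    below : ∀ {i j p} k l → isCycleLeader σ i ≡ true → iter σ k i ≡ p → iter σ l j ≡ p → toℕ i ≤ toℕ j
    below {i} {j} k l li ik jl with iter-sym l jl
    ... | m , pm = subst (λ x → toℕ i ≤ toℕ x)
      (trans (iter-+ k m i) (trans (cong (iter σ m) ik) pm)) (leader-min i li (k + m))

  count-nontrivial : ∀ p → (∀ x → app σ x ≢ x → ∃ λ k → iter σ k x ≡ p) →
    length (filter (λ k → ¬? (k ≟ 1)) (cycleLengths σ)) ≤ 1
  count-nontrivial p hits = subst (_≤ 1) (sym (length-filter-map (λ k → ¬? (k ≟ 1)) (orbitLength σ) (filter leader? (allFin n))))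
    (length-filter-subsingleton _ (unique-filter⁺ leader? (allFin⁺ n)) λ i∈ j∈ i≢1 j≢1 →
      same-orbit-leaders (proj₂ (∈-filter⁻ leader? {xs = allFin n} i∈)) (proj₂ (∈-filter⁻ leader? {xs = allFin n} j∈))
        (hits _ (i≢1 ∘ fixed⇒orbitLength≡1 _)) (hits _ (j≢1 ∘ fixed⇒orbitLength≡1 _)))

  -- If all points but p move weakly down, a cycle avoiding p is constant; likewise upwards.
  monotone-but-one : ∀ p → (∀ x → x ≢ p → toℕ (app σ x) ≤ toℕ x) ⊎ (∀ x → x ≢ p → toℕ x ≤ toℕ (app σ x)) →
    ∀ x → app σ x ≢ x → ∃ λ k → iter σ k x ≡ p
  monotone-but-one p mono x moved with period x
  ... | l , 0<l , _ , ret with any? (λ (k : Fin l) → iter σ (toℕ k) x Fin.≟ p)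
  ...   | yes (k , hit) = toℕ k , hit
  ...   | no avoids = ⊥-elim (moved (toℕ-injective (fixed mono)))
    where
    avoids′ : ∀ k → k < l → iter σ k x ≢ p
    avoids′ k k<l hit = avoids (fromℕ< k<l , trans (cong (λ j → iter σ j x) (toℕ-fromℕ< k<l)) hit)

    fixed : _ ⊎ _ → toℕ (app σ x) ≡ toℕ x
    -- The turn starts with a weak descent from `x`, and the rest of it descends weakly from
    -- `app σ x` back to `x`, so all values agree.
    fixed (inj₁ down) = ≤-antisym (down x (avoids′ 0 0<l)) (returned l 0<l ≤-refl ret)
      where
      chain : ∀ k → suc k ≤ l → toℕ (iter σ (suc k) x) ≤ toℕ (app σ x)
      chain zero    _ = ≤-refl
      chain (suc k) h = ≤-trans (subst (λ y → toℕ y ≤ toℕ (iter σ (suc k) x)) (sym (iter-suc (suc k) x)) (down _ (avoids′ (suc k) h)))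
                                (chain k (<⇒≤ h))
      returned : ∀ l′ → 0 < l′ → l′ ≤ l → iter σ l′ x ≡ x → toℕ x ≤ toℕ (app σ x)
      returned (suc k) _ h r = subst (λ y → toℕ y ≤ toℕ (app σ x)) r (chain k h)
    fixed (inj₂ up) = ≤-antisym (returned l 0<l ≤-refl ret) (up x (avoids′ 0 0<l))
      where
      chain : ∀ k → suc k ≤ l → toℕ (app σ x) ≤ toℕ (iter σ (suc k) x)
      chain zero    _ = ≤-refl
      chain (suc k) h = ≤-trans (chain k (<⇒≤ h))
        (subst (λ y → toℕ (iter σ (suc k) x) ≤ toℕ y) (sym (iter-suc (suc k) x)) (up _ (avoids′ (suc k) h)))
      returned : ∀ l′ → 0 < l′ → l′ ≤ l → iter σ l′ x ≡ x → toℕ (app σ x) ≤ toℕ x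
      returned (suc k) _ h r = subst (λ y → toℕ (app σ x) ≤ toℕ y) r (chain k h)

-- Recognising the cycle types (n) and (n - 1, 1)

module _ {m : ℕ} (σ : Permutation′ (suc m)) where
  open Orbit σ
  open CycleType σ

  zero-leader : isCycleLeader σ zero ≡ true
  zero-leader = min-leader zero λ _ → z≤n

  reached-leader : ∀ {i} → (∃ λ k → iter σ k zero ≡ i) → isCycleLeader σ i ≡ true → i ≡ zero
  reached-leader {i} (k , eq) lead = same-orbit-leaders lead zero-leader (0 , refl) (k , eq)

  -- Exponents are reduced modulo the orbit length, so that the reached points inject into
  -- `Fin (orbitLength σ zero)` and bound the orbit length from below.
  reached-index : ∀ {i} → (∃ λ k → iter σ k zero ≡ i) → ∃ λ (r : Fin (orbitLength σ zero)) → iter σ (toℕ r) zero ≡ i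
  reached-index (k , eq) = fromℕ< (m%n<n k ℓ) , trans (cong (λ j → iter σ j zero) (toℕ-fromℕ< (m%n<n k ℓ)))
      (trans (sym (iter-% k ℓ (proj₁ (proj₂ (orbitLength-spec zero))))) eq)
    where
    ℓ = orbitLength σ zero
    instance ℓ≢0 : NonZero ℓ
             ℓ≢0 = >-nonZero (proj₁ (orbitLength-spec zero))

  index-injective : ∀ {i j} (ri : ∃ λ k → iter σ k zero ≡ i) (rj : ∃ λ k → iter σ k zero ≡ j) →
    proj₁ (reached-index ri) ≡ proj₁ (reached-index rj) → i ≡ j
  index-injective ri rj eq = trans (sym (proj₂ (reached-index ri)))
    (trans (cong (λ r → iter σ (toℕ r) zero) eq) (proj₂ (reached-index rj)))

  transitive⇒cycleType : (∀ i → ∃ λ k → iter σ k zero ≡ i) → HasCycleType σ (suc m ∷ [])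
  transitive⇒cycleType reach = ↭-reflexive (begin
    map (orbitLength σ) (filter leader? (allFin (suc m)))
      ≡⟨ cong (map (orbitLength σ)) (filter-unique leader? (allFin⁺ (suc m)) (∈-allFin zero) zero-leader
          λ {y} _ → reached-leader (reach y)) ⟩
    orbitLength σ zero ∷ []
      ≡⟨ cong (_∷ []) (≤-antisym (orbitLength≤n zero) (injective⇒≤ λ {i} {j} → index-injective (reach i) (reach j))) ⟩
    suc m ∷ [] ∎)
    where open ≡-Reasoning

  -- The leaders are `zero` and `φ`, in this order. The orbit of `zero` has exactly `m` points: the
  -- points other than `φ` inject into its exponents, and its distinct iterates avoid `φ`.
  transitive-but-one⇒cycleType : ∀ φ → app σ φ ≡ φ → φ ≢ zero →
    (∀ i → i ≢ φ → ∃ λ k → iter σ k zero ≡ i) → HasCycleType σ (m ∷ 1 ∷ [])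
  transitive-but-one⇒cycleType φ fix φ≢0 reach = ↭-reflexive (begin
    map (orbitLength σ) (filter leader? (allFin (suc m)))
      ≡⟨ cong (map (orbitLength σ)) (filter-accept leader? zero-leader) ⟩
    orbitLength σ zero ∷ map (orbitLength σ) (filter leader? (tabulate suc))
      ≡⟨ cong (λ xs → orbitLength σ zero ∷ map (orbitLength σ) xs)
           (filter-unique leader? (tail-unique (allFin⁺ (suc m))) (φ∈ (∈-allFin φ)) φ-leader only) ⟩
    orbitLength σ zero ∷ orbitLength σ φ ∷ []
      ≡⟨ cong₂ (λ k l → k ∷ l ∷ []) (≤-antisym upper lower) (fixed⇒orbitLength≡1 φ fix) ⟩
    m ∷ 1 ∷ [] ∎)
    where
    open ≡-Reasoning

    tail-unique : ∀ {x : Fin (suc m)} {xs} → Unique (x ∷ xs) → Unique xs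
    tail-unique (_ ∷ u) = u

    φ∈ : φ ∈ allFin (suc m) → φ ∈ tabulate suc
    φ∈ (here eq)  = contradiction eq φ≢0
    φ∈ (there p)  = p

    φ-fixed : ∀ k → iter σ k φ ≡ φ
    φ-fixed zero    = refl
    φ-fixed (suc k) = trans (cong (iter σ k) fix) (φ-fixed k)

    φ-leader : isCycleLeader σ φ ≡ true
    φ-leader = min-leader φ λ j → ≤-reflexive (cong toℕ (sym (φ-fixed j)))

    only : ∀ {y} → y ∈ tabulate suc → isCycleLeader σ y ≡ true → y ≡ φ
    only {y} y∈ lead with y Fin.≟ φ
    ... | yes eq = eq
    ... | no ≢φ with ∈-tabulate⁻ y∈
    ...   | j , refl = contradiction (reached-leader (reach y ≢φ) lead) λ ()

    φ-missed : ∀ k → φ ≢ iter σ k zero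
    φ-missed k eq = φ≢0 (iter-injective k (trans (φ-fixed k) eq))

    lower : m ≤ orbitLength σ zero
    lower = injective⇒≤ λ {i} {j} eq → punchIn-injective φ i j
      (index-injective (reach (punchIn φ i) (punchInᵢ≢i φ i)) (reach (punchIn φ j) (punchInᵢ≢i φ j)) eq)

    upper : orbitLength σ zero ≤ m
    upper = injective⇒≤ {f = λ (r : Fin (orbitLength σ zero)) → punchOut (φ-missed (toℕ r))} λ {r} {s} eq →
      toℕ-injective (distinct r s (punchOut-injective (φ-missed (toℕ r)) (φ-missed (toℕ s)) eq))
      where
      distinct : ∀ (r s : Fin (orbitLength σ zero)) → iter σ (toℕ r) zero ≡ iter σ (toℕ s) zero → toℕ r ≡ toℕ s
      distinct r s eq with <-cmp (toℕ r) (toℕ s)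
      ... | tri< r<s _ _ = contradiction eq (iterates-distinct zero _ _ r<s (toℕ<n s))
      ... | tri≈ _ e _   = e
      ... | tri> _ _ s<r = contradiction (sym eq) (iterates-distinct zero _ _ s<r (toℕ<n r))

-- Row insertion

-- The graph of `rowInsert`: proofs can go by induction on the place where the letter stops instead
-- of on Boolean tests.
data RowInsert (a : ℕ) : List ℕ → List ℕ → Maybe ℕ → Set where
  append : RowInsert a [] (a ∷ []) nothing
  bump   : ∀ {b bs} → a < b → RowInsert a (b ∷ bs) (a ∷ bs) (just b)
  pass   : ∀ {b bs bs′ m} → b ≤ a → RowInsert a bs bs′ m → RowInsert a (b ∷ bs) (b ∷ bs′) m

rowInsert-graph : ∀ a r → RowInsert a r (proj₁ (rowInsert a r)) (proj₂ (rowInsert a r))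
rowInsert-graph a []       = append
rowInsert-graph a (b ∷ bs) with a <ᵇ b in eq
... | true  = bump (<ᵇ⇒< a b (subst T (sym eq) _))
... | false = pass (≮⇒≥ λ a<b → subst T eq (<⇒<ᵇ a<b)) (rowInsert-graph a bs)

rowInsert-unique : ∀ {a r r′ m} → RowInsert a r r′ m → rowInsert a r ≡ (r′ , m)
rowInsert-unique append = refl
rowInsert-unique {a} (bump {b} a<b) with a <ᵇ b | <⇒<ᵇ a<b
... | true | _ = refl
rowInsert-unique {a} (pass {b} b≤a ins) with a <ᵇ b in eq
... | true  = contradiction (<ᵇ⇒< a b (subst T (sym eq) _)) (≤⇒≯ b≤a)
... | false rewrite rowInsert-unique ins = refl

module _ {a : ℕ} where

  inserted∈ : ∀ {r r′ m} → RowInsert a r r′ m → a ∈ r′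
  inserted∈ append       = here refl
  inserted∈ (bump _)     = here refl
  inserted∈ (pass _ ins) = there (inserted∈ ins)

  kept : ∀ {r r′ m c} → RowInsert a r r′ m → c ∈ r → c ∈ r′ ⊎ m ≡ just c
  kept (bump _)     (here refl) = inj₂ refl
  kept (bump _)     (there c∈)  = inj₁ (there c∈)
  kept (pass _ ins) (here refl) = inj₁ (here refl)
  kept (pass _ ins) (there c∈)  = Data.Sum.map₁ there (kept ins c∈)

  bumps : ∀ {r r′ m c} → RowInsert a r r′ m → c ∈ r → a < c → ∃ λ b → m ≡ just b
  bumps (bump _)       _           _   = _ , refl
  bumps (pass b≤a ins) (here refl) a<c = contradiction a<c (≤⇒≯ b≤a)
  bumps (pass _ ins)   (there c∈)  a<c = bumps ins c∈ a<c

  bumped> : ∀ {r r′ b} → RowInsert a r r′ (just b) → a < b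
  bumped> (bump a<b)   = a<b
  bumped> (pass _ ins) = bumped> ins

  bumped≤ : ∀ {r r′ b c} → AllPairs _≤_ r → RowInsert a r r′ (just b) → c ∈ r → a < c → b ≤ c
  bumped≤ _          (bump _)       (here refl) _   = ≤-refl
  bumped≤ (b≤ ∷ _)   (bump _)       (there c∈)  _   = All.lookup b≤ c∈
  bumped≤ _          (pass b≤a _)   (here refl) a<c = contradiction a<c (≤⇒≯ b≤a)
  bumped≤ (_ ∷ s)    (pass _ ins)   (there c∈)  a<c = bumped≤ s ins c∈ a<c

  All-rowInsert : ∀ {p} {Q : Pred ℕ p} {r r′ m} → RowInsert a r r′ m → Q a → All Q r → All Q r′
  All-rowInsert append       qa _        = qa ∷ []
  All-rowInsert (bump _)     qa (_ ∷ qs) = qa ∷ qs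
  All-rowInsert (pass _ ins) qa (q ∷ qs) = q ∷ All-rowInsert ins qa qs

  sorted-rowInsert : ∀ {r r′ m} → RowInsert a r r′ m → AllPairs _≤_ r → AllPairs _≤_ r′
  sorted-rowInsert append         _        = [] ∷ []
  sorted-rowInsert (bump a<b)     (b≤ ∷ s) = All.map (≤-trans (<⇒≤ a<b)) b≤ ∷ s
  sorted-rowInsert (pass b≤a ins) (b≤ ∷ s) = All-rowInsert ins b≤a b≤ ∷ sorted-rowInsert ins s

  appended : ∀ {r r′} → RowInsert a r r′ nothing → r′ ≡ r ++ a ∷ []
  appended append       = refl
  appended (pass _ ins) = cong (_ ∷_) (appended ins)

  replaced : ∀ {r r′ b} → RowInsert a r r′ (just b) → ∃₂ λ u v → r ≡ u ++ b ∷ v × r′ ≡ u ++ a ∷ v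
  replaced (bump _)     = [] , _ , refl , refl
  replaced (pass _ ins) with replaced ins
  ... | u , v , refl , refl = _ ∷ u , v , refl , refl

  length-append : ∀ {r r′} → RowInsert a r r′ nothing → length r′ ≡ suc (length r)
  length-append append       = refl
  length-append (pass _ ins) = cong suc (length-append ins)

  length-bump : ∀ {r r′ b} → RowInsert a r r′ (just b) → length r′ ≡ length r
  length-bump (bump _)     = refl
  length-bump (pass _ ins) = cong suc (length-bump ins)

ins : List (List ℕ) → ℕ → List (List ℕ)
ins t a = insertTableau a t

top : List (List ℕ) → List ℕ
top []      = []
top (r ∷ _) = r

below : List (List ℕ) → List (List ℕ)
below []       = []
below (_ ∷ rs) = rs

-- Separates an insertion into its effect on the first row and at most one insertion into the
-- tableau below, with the empty tableau treated as an empty first row.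
insert-view : ∀ a t → ∃ λ m → RowInsert a (top t) (top (ins t a)) m ×
  below (ins t a) ≡ maybe (ins (below t)) (below t) m
insert-view a []       = nothing , append , refl
insert-view a (r ∷ rs) with rowInsert a r | rowInsert-graph a r
... | r′ , nothing | g = nothing , g , refl
... | r′ , just b  | g = just b  , g , refl

cells : List (List ℕ) → ℕ
cells t = sum (Γ t)

cells-insert : ∀ a t → cells (ins t a) ≡ suc (cells t)
cells-insert a []       = refl
cells-insert a (r ∷ rs) with rowInsert a r | rowInsert-graph a r
... | r′ , nothing | g = cong (_+ cells rs) (length-append g)
... | r′ , just b  | g = trans (cong₂ _+_ (length-bump g) (cells-insert b rs)) (+-suc _ _)

-- Words containing the pattern 321

-- There is a cell in the third row or further down. Counting cells makes persistence under
-- insertion immediate.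
Deep : List (List ℕ) → Set
Deep t = 0 < cells (below (below t))

cells-below-mono : ∀ a t → cells (below t) ≤ cells (below (ins t a))
cells-below-mono a t with insert-view a t
... | nothing , _ , eq = ≤-reflexive (cong cells (sym eq))
... | just b  , _ , eq = subst (λ s → cells (below t) ≤ cells s) (sym eq)
                           (≤-trans (n≤1+n _) (≤-reflexive (sym (cells-insert b (below t)))))

deep-step : ∀ a t → Deep t → Deep (ins t a)
deep-step a t d with insert-view a t
... | nothing , _ , eq rewrite eq = d
... | just b  , _ , eq rewrite eq = <-≤-trans d (cells-below-mono b (below t))

deep-fold : ∀ w t → Deep t → Deep (foldl ins t w)
deep-fold []      t d = d
deep-fold (a ∷ w) t d = deep-fold w (ins t a) (deep-step a t d)

deep-bump : ∀ {a b t m} → RowInsert b (top (below t)) (top (ins (below t) b)) m → ∀ {c} → m ≡ just c →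
  below (ins t a) ≡ ins (below t) b → Deep (ins t a)
deep-bump {a} {b} {t} g {c} refl eq rewrite eq with insert-view b (below t)
... | nothing , g′ , _ = case trans (sym (cong proj₂ (rowInsert-unique g))) (cong proj₂ (rowInsert-unique g′)) of λ ()
... | just d  , _ , eq′ rewrite eq′ = subst (0 <_) (sym (cells-insert d (below (below t)))) z<s

-- The trace of the first letter `c` of a pattern c > b > a: it stays in the first two rows until a
-- third row appears.
Low₁ : ℕ → List (List ℕ) → Set
Low₁ c t = Deep t ⊎ (c ∈ top t ⊎ c ∈ top (below t))

-- The trace of the first two letters: `b` is in the first row with some larger entry in the second,
-- so a bump of `b` or of anything smaller causes a second bump.
Low₂ : ℕ → List (List ℕ) → Set
Low₂ b t = Deep t ⊎ (b ∈ top t × ∃ λ z → z ∈ top (below t) × b < z)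

second-row-kept : ∀ a t {z} → z ∈ top (below t) → Deep (ins t a) ⊎ z ∈ top (below (ins t a))
second-row-kept a t z∈ with insert-view a t
... | nothing , _ , eq rewrite eq = inj₂ z∈
... | just b  , _ , eq with insert-view b (below t)
...   | m , g , _ with kept g z∈
...     | inj₁ stays  = inj₂ (subst (λ s → _ ∈ top s) (sym eq) stays)
...     | inj₂ bumped = inj₁ (deep-bump {a} {b} {t} g bumped eq)

low₁-step : ∀ a t {c} → Low₁ c t → Low₁ c (ins t a)
low₁-step a t (inj₁ d) = inj₁ (deep-step a t d)
low₁-step a t (inj₂ (inj₂ c∈)) = Data.Sum.map₂ inj₂ (second-row-kept a t c∈)
low₁-step a t (inj₂ (inj₁ c∈)) with insert-view a t
... | m , g , eq with kept g c∈
...   | inj₁ stays = inj₂ (inj₁ stays)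
...   | inj₂ refl rewrite eq = inj₂ (inj₂ (inserted∈ (proj₁ (proj₂ (insert-view _ (below t))))))

-- The larger entry of the second row is `c` itself if `c` has already descended; otherwise `c`
-- forces `b` to bump some entry greater than `b`.
low₁⇒low₂ : ∀ b t {c} → b < c → Low₁ c t → Low₂ b (ins t b)
low₁⇒low₂ b t b<c (inj₁ d) = inj₁ (deep-step b t d)
low₁⇒low₂ b t b<c (inj₂ (inj₂ c∈)) with second-row-kept b t c∈
... | inj₁ d   = inj₁ d
... | inj₂ c∈′ = inj₂ (inserted∈ (proj₁ (proj₂ (insert-view b t))) , _ , c∈′ , b<c)
low₁⇒low₂ b t b<c (inj₂ (inj₁ c∈)) with insert-view b t
... | m , g , eq with bumps g c∈ b<c
...   | e , refl rewrite eq = inj₂ (inserted∈ g , e , inserted∈ (proj₁ (proj₂ (insert-view e (below t)))) , bumped> g)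

bump-twice : ∀ a t {b z} → RowInsert a (top t) (top (ins t a)) (just b) → below (ins t a) ≡ ins (below t) b →
  z ∈ top (below t) → b < z → Deep (ins t a)
bump-twice a t {b} g eq z∈ b<z with insert-view b (below t)
... | m , g′ , _ with bumps g′ z∈ b<z
...   | c , m≡ = deep-bump {a} {b} {t} g′ m≡ eq

low₂-step : ∀ a t {b} → Low₂ b t → Low₂ b (ins t a)
low₂-step a t (inj₁ d) = inj₁ (deep-step a t d)
low₂-step a t (inj₂ (b∈ , z , z∈ , b<z)) with insert-view a t
... | m , g , eq with kept g b∈
...   | inj₂ refl  = inj₁ (bump-twice a t g eq z∈ b<z)
...   | inj₁ stays with second-row-kept a t z∈
...     | inj₁ d   = inj₁ d
...     | inj₂ z∈′ = inj₂ (stays , z , z∈′ , b<z)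

-- In a sorted row the bumped entry is the least one above `a`, hence at most `b` and smaller than
-- `z`; it bumps again in the second row.
low₂⇒deep : ∀ a t {b} → AllPairs _≤_ (top t) → a < b → Low₂ b t → Deep (ins t a)
low₂⇒deep a t sorted a<b (inj₁ d) = deep-step a t d
low₂⇒deep a t sorted a<b (inj₂ (b∈ , z , z∈ , b<z)) with insert-view a t
... | m , g , eq with bumps g b∈ a<b
...   | e , refl = bump-twice a t g eq z∈ (≤-<-trans (bumped≤ sorted g b∈ a<b) b<z)

sorted-step : ∀ a t → AllPairs _≤_ (top t) → AllPairs _≤_ (top (ins t a))
sorted-step a t = sorted-rowInsert (proj₁ (proj₂ (insert-view a t)))

module _ {a b c : ℕ} (a<b : a < b) (b<c : b < c) where

  fold₂ : ∀ {w} t → (a ∷ []) ⊆ w → AllPairs _≤_ (top t) → Low₂ b t → Deep (foldl ins t w)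
  fold₂ t (x ∷ʳ s)            sorted low = fold₂ (ins t x) s (sorted-step x t sorted) (low₂-step x t low)
  fold₂ t (_∷_ {ys = w} refl s) sorted low = deep-fold w (ins t a) (low₂⇒deep a t sorted a<b low)

  fold₁ : ∀ {w} t → (b ∷ a ∷ []) ⊆ w → AllPairs _≤_ (top t) → Low₁ c t → Deep (foldl ins t w)
  fold₁ t (x ∷ʳ s)   sorted low = fold₁ (ins t x) s (sorted-step x t sorted) (low₁-step x t low)
  fold₁ t (refl ∷ s) sorted low = fold₂ (ins t b) s (sorted-step b t sorted) (low₁⇒low₂ b t b<c low)

  decreasing⇒deep : ∀ {w} t → (c ∷ b ∷ a ∷ []) ⊆ w → AllPairs _≤_ (top t) → Deep (foldl ins t w)
  decreasing⇒deep t (x ∷ʳ s)   sorted = decreasing⇒deep (ins t x) s (sorted-step x t sorted)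
  decreasing⇒deep t (refl ∷ s) sorted = fold₁ (ins t c) s (sorted-step c t sorted)
    (inj₂ (inj₁ (inserted∈ (proj₁ (proj₂ (insert-view c t))))))

-- Fixed letters of words with a two-row shape

-- The column condition between a row and the row below it, required along the lower row only.
data Dominates : List ℕ → List ℕ → Set where
  nil  : ∀ {r} → Dominates r []
  cons : ∀ {x y r s} → x < y → Dominates r s → Dominates (x ∷ r) (y ∷ s)

dominates-length : ∀ {r s} → Dominates r s → length s ≤ length r
dominates-length nil        = z≤n
dominates-length (cons _ d) = s≤s (dominates-length d)

dominates-append : ∀ {a r r′ s} → RowInsert a r r′ nothing → Dominates r s → Dominates r′ s
dominates-append _              nil          = nil
dominates-append (pass _ g) (cons x<y d) = cons x<y (dominates-append g d)

-- As `b` is appended to the lower row, it is at least each of its entries. By dominance it came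
-- from a column beyond the end of that row, so its new cell lies below an entry smaller than `b`.
dominates-bump : ∀ {a b r r′ s s′} → RowInsert a r r′ (just b) → RowInsert b s s′ nothing →
  Dominates r s → Dominates r′ s′
dominates-bump (bump a<b)     append         nil          = cons a<b nil
dominates-bump (pass c≤a g)   append         nil          = cons (≤-<-trans c≤a (bumped> g)) nil
dominates-bump (bump a<b)     (pass y≤b _)   (cons b<y d) = contradiction b<y (≤⇒≯ y≤b)
dominates-bump (pass c≤a g)   (pass _ g′)    (cons x<y d) = cons x<y (dominates-bump g g′ d)

module FixedLetters {Flag : Pred ℕ 0ℓ} (flag? : Decidable Flag) where

  plain? : Decidable (λ x → ¬ Flag x)
  plain? x = ¬? (flag? x)

  -- Here `x` precedes `y` in the word: a flagged letter exceeds all earlier letters and is exceeded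
  -- by all later ones.
  Compatible : ℕ → ℕ → Set
  Compatible x y = (Flag y → x < y) × (Flag x → x < y)

  -- Flagged entries are smaller than the incoming letter and are passed, so insertion commutes with
  -- deleting them.
  plain-rowInsert : ∀ {a r r′ m} → ¬ Flag a → All (λ x → Compatible x a) r → RowInsert a r r′ m →
    RowInsert a (filter plain? r) (filter plain? r′) m
  plain-rowInsert ¬fa _ append rewrite filter-accept plain? {xs = []} ¬fa = append
  plain-rowInsert {a} ¬fa ((_ , below) ∷ _) (bump {b} {bs} a<b)
    rewrite filter-accept plain? {xs = bs} ¬fa
          | filter-accept plain? {b} {xs = bs} (λ fb → <-asym a<b (below fb)) = bump a<b
  plain-rowInsert ¬fa (_ ∷ cs) (pass {b} b≤a g) with flag? b
  ... | yes _ = plain-rowInsert ¬fa cs g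
  ... | no _  = pass b≤a (plain-rowInsert ¬fa cs g)

  flagged-rowInsert : ∀ {a r r′ m} → Flag a → All (λ x → Compatible x a) r → RowInsert a r r′ m →
    m ≡ nothing × filter plain? r′ ≡ filter plain? r
  flagged-rowInsert fa _ append = refl , filter-reject plain? (λ ¬fa → ¬fa fa)
  flagged-rowInsert fa ((low , _) ∷ _) (bump a<b) = contradiction a<b (<-asym (low fa))
  flagged-rowInsert fa (_ ∷ cs) (pass {b} b≤a g) with flagged-rowInsert fa cs g
  ... | m≡ , eq with flag? b
  ...   | yes _ = m≡ , eq
  ...   | no _  = m≡ , cong (b ∷_) eq

  -- The number `k` counts the flagged letters read so far, all of which remain in the first row.
  -- Dominance is kept for the row of plain letters, which is what bounds the second row.
  record State (k : ℕ) (t : List (List ℕ)) : Set where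
    constructor state
    field
      dominance : Dominates (filter plain? (top t)) (top (below t))
      balance   : length (top t) ≡ length (filter plain? (top t)) + k

  flags : List ℕ → ℕ
  flags w = length (filter flag? w)

  step-flagged : ∀ {k} a t → Flag a → All (λ x → Compatible x a) (top t) → State k t → State (suc k) (ins t a)
  step-flagged a t fa cs (state dom bal) with insert-view a t
  ... | m , g , eq with flagged-rowInsert fa cs g
  ...   | refl , same =
    state (subst₂ Dominates (sym same) (cong top (sym eq)) dom)
          (trans (length-append g) (trans (cong suc bal) (trans (sym (+-suc _ _)) (cong (λ r → length r + _) (sym same)))))

  step-plain : ∀ {k} a t → ¬ Flag a → All (λ x → Compatible x a) (top t) → ¬ Deep (ins t a) →
    State k t → State k (ins t a)
  step-plain a t ¬fa cs shallow (state dom bal) with insert-view a t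
  ... | nothing , g , eq =
    state (subst (Dominates _) (cong top (sym eq)) (dominates-append g° dom)) (trans (length-append g) (trans (cong suc bal) (cong (_+ _) (sym (length-append g°)))))
    where g° = plain-rowInsert ¬fa cs g
  ... | just b  , g , eq with insert-view b (below t)
  ...   | just c  , g′ , _ = contradiction (deep-bump {a} {b} {t} g′ refl eq) shallow
  ...   | nothing , g′ , _ =
    state (subst (Dominates _) (cong top (sym eq)) (dominates-bump g° g′ dom)) (trans (length-bump g) (trans bal (cong (_+ _) (sym (length-bump g°)))))
    where g° = plain-rowInsert ¬fa cs g

  fold-state : ∀ {k} w t → AllPairs Compatible w → All (λ x → All (Compatible x) w) (top t) →
    ¬ Deep (foldl ins t w) → State k t → State (flags w + k) (foldl ins t w)
  fold-state []      t _         _   _       s = s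
  fold-state {k} (a ∷ w) t (ca ∷ cw) cts shallow s with flag? a
  ... | yes fa = subst (λ j → State j (foldl ins (ins t a) w)) (+-suc (flags w) k)
    (fold-state w (ins t a) cw later shallow (step-flagged a t fa (All.map All.head cts) s))
    where later = All-rowInsert (proj₁ (proj₂ (insert-view a t))) ca (All.map All.tail cts)
  ... | no ¬fa =
    fold-state w (ins t a) cw later shallow
      -- A third row never disappears, so a final tableau without one had none at any earlier stage.
      (step-plain a t ¬fa (All.map All.head cts) (shallow ∘ deep-fold w (ins t a)) s)
    where later = All-rowInsert (proj₁ (proj₂ (insert-view a t))) ca (All.map All.tail cts)

  two-rows⇒few-flags : ∀ {w p q} → AllPairs Compatible w → Γ (P w) ≡ p ∷ q ∷ [] → q + flags w ≤ p
  two-rows⇒few-flags {w} {p} {q} compatible shape with P w | fold-state {0} w [] compatible [] | shape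
  ... | r ∷ s ∷ [] | final | refl with final (λ ()) (state nil refl)
  ...   | state dom bal = begin
    length s + flags w                          ≤⟨ +-monoˡ-≤ (flags w) (dominates-length dom) ⟩
    length (filter plain? r) + flags w          ≡⟨ cong (_ +_) (sym (+-identityʳ (flags w))) ⟩
    length (filter plain? r) + (flags w + 0)    ≡⟨ sym bal ⟩
    length r                                    ∎
    where open ≤-Reasoning

-- Words of shape (n − 1, 1)

AllPairs-++⁻ˡ : ∀ {xs ys} → AllPairs _≤_ (xs ++ ys) → AllPairs _≤_ xs
AllPairs-++⁻ˡ {[]}     _        = []
AllPairs-++⁻ˡ {x ∷ xs} (p ∷ ps) = All.++⁻ˡ xs p ∷ AllPairs-++⁻ˡ ps

AllPairs-++⁻ʳ : ∀ xs {ys} → AllPairs _≤_ (xs ++ ys) → AllPairs _≤_ ys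
AllPairs-++⁻ʳ []       ps       = ps
AllPairs-++⁻ʳ (x ∷ xs) (_ ∷ ps) = AllPairs-++⁻ʳ xs ps

AllPairs-++⁻ : ∀ xs {ys} → AllPairs _≤_ (xs ++ ys) → All (λ x → All (x ≤_) ys) xs
AllPairs-++⁻ []       _        = []
AllPairs-++⁻ (x ∷ xs) (p ∷ ps) = All.++⁻ʳ xs p ∷ AllPairs-++⁻ xs ps

cells-below-fold : ∀ w t → cells (below t) ≤ cells (below (foldl ins t w))
cells-below-fold []      t = ≤-refl
cells-below-fold (a ∷ w) t = ≤-trans (cells-below-mono a t) (cells-below-fold w (ins t a))

-- If nothing is added below, every letter is appended, and the first row followed by the unread
-- letters is the final first row.
no-bump⇒sorted : ∀ w t → AllPairs _≤_ (top t) → cells (below (foldl ins t w)) ≤ cells (below t) →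
  AllPairs _≤_ (top t ++ w)
no-bump⇒sorted []      t sorted _  = subst (AllPairs _≤_) (sym (++-identityʳ (top t))) sorted
no-bump⇒sorted (a ∷ w) t sorted le with insert-view a t
... | nothing , g , eq = subst (AllPairs _≤_) (trans (cong (_++ w) (appended g)) (++-assoc (top t) _ w))
  (no-bump⇒sorted w (ins t a) (sorted-step a t sorted) (subst (λ s → cells (below (foldl ins (ins t a) w)) ≤ cells s) (sym eq) le))
... | just b  , g , eq = contradiction (≤-trans (cells-below-fold w (ins t a)) le)
  (<⇒≱ (≤-reflexive (sym (trans (cong cells eq) (cells-insert b (below t))))))

-- The letter `a` bumps `b` out of the first row `u₁ b u₂`; `before` concerns this row and `after`
-- the final first row.
record OneBump (w : List ℕ) : Set where
  constructor oneBump
  field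
    {a b}   : ℕ
    u₁ u₂ v : List ℕ
    word    : w ≡ u₁ ++ b ∷ u₂ ++ a ∷ v
    before  : AllPairs _≤_ (u₁ ++ b ∷ u₂)
    after   : AllPairs _≤_ (u₁ ++ a ∷ u₂ ++ v)

single-bump : ∀ w t → AllPairs _≤_ (top t) → cells (below t) ≡ 0 → cells (below (foldl ins t w)) ≡ 1 → OneBump (top t ++ w)
single-bump []      t sorted z o = case trans (sym z) o of λ ()
single-bump (a ∷ w) t sorted z o with insert-view a t
... | nothing , g , eq = subst OneBump (trans (cong (_++ w) (appended g)) (++-assoc (top t) _ w))
  (single-bump w (ins t a) (sorted-step a t sorted) (trans (cong cells eq) z) o)
... | just b  , g , eq with replaced g
...   | u , v , r≡ , r′≡ = oneBump u v w
  (trans (cong (_++ a ∷ w) r≡) (++-assoc u (b ∷ v) (a ∷ w)))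
  (subst (AllPairs _≤_) r≡ sorted)
  (subst (AllPairs _≤_) (trans (cong (_++ w) r′≡) (++-assoc u (a ∷ v) w))
    (no-bump⇒sorted w (ins t a) (sorted-step a t sorted)
      (≤-reflexive (trans o (sym (trans (cong cells eq) (trans (cells-insert b (below t)) (cong suc z))))))))

-- One letter `y` disturbs the order. In `early` only pairs beginning with `y` can be inverted, in
-- `late` only pairs ending with it.
data AlmostSorted (w : List ℕ) : Set where
  early : ∀ s y t → w ≡ s ++ y ∷ t → AllPairs _≤_ (s ++ t) → All (_≤ y) s → AlmostSorted w
  late  : ∀ s y t → w ≡ s ++ y ∷ t → AllPairs _≤_ (s ++ t) → All (y ≤_) t → AlmostSorted w

-- If `a` follows `b` at once, `b` is the letter to delete. Otherwise it is `a`: a letter `z`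
-- between them gives `b ≤ z`, and `z` is at most every letter of `v`, so `u₁ b u₂ v` is sorted.
almost-sorted : ∀ {w} → OneBump w → AlmostSorted w
almost-sorted (oneBump {a} {b} u₁ [] v word before after) =
  early u₁ b (a ∷ v) word after (All.map (λ { (p ∷ []) → p }) (AllPairs-++⁻ u₁ before))
almost-sorted (oneBump {a} {b} u₁ (z ∷ zs) v word before after) =
  late (u₁ ++ b ∷ z ∷ zs) a v (trans word (sym (++-assoc u₁ (b ∷ z ∷ zs) (a ∷ v))))
    (AllPairs.++⁺ before v-sorted cross)
    (All.++⁻ʳ (z ∷ zs) (All-head (AllPairs-++⁻ʳ u₁ after)))
  where
  All-head : ∀ {x xs} → AllPairs _≤_ (x ∷ xs) → All (x ≤_) xs
  All-head (p ∷ _) = p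

  AllPairs-tail : ∀ {x xs} → AllPairs _≤_ (x ∷ xs) → AllPairs _≤_ xs
  AllPairs-tail (_ ∷ p) = p

  zs-v : AllPairs _≤_ (z ∷ zs ++ v)
  zs-v = AllPairs-tail (AllPairs-++⁻ʳ u₁ after)

  v-sorted : AllPairs _≤_ v
  v-sorted = AllPairs-++⁻ʳ (z ∷ zs) zs-v

  b≤z : b ≤ z
  b≤z = All.head (All-head (AllPairs-++⁻ʳ u₁ before))

  zs≤v : All (λ x → All (x ≤_) v) (z ∷ zs)
  zs≤v = AllPairs-++⁻ (z ∷ zs) zs-v

  cross : All (λ x → All (x ≤_) v) (u₁ ++ b ∷ z ∷ zs)
  cross = All.++⁺ (All.map (λ p → All.++⁻ʳ (z ∷ zs) (All.tail p)) (AllPairs-++⁻ u₁ after))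
                 (All.map (≤-trans b≤z) (All.head zs≤v) ∷ zs≤v)

AllPairs-tabulate⁻ : ∀ {n} (g : Fin n → ℕ) → AllPairs _≤_ (tabulate g) → ∀ x y → toℕ x < toℕ y → g x ≤ g y
AllPairs-tabulate⁻ g (p ∷ _) zero    (suc y) _       = All.tabulate⁻ p y
AllPairs-tabulate⁻ g (_ ∷ p) (suc x) (suc y) (s≤s l) = AllPairs-tabulate⁻ (g ∘ suc) p x y l

early-index : ∀ {n} (g : Fin n → ℕ) s y t → tabulate g ≡ s ++ y ∷ t → AllPairs _≤_ (s ++ t) → All (_≤ y) s →
  ∃ λ p → ∀ x → x ≢ p → ∀ z → toℕ x < toℕ z → g x ≤ g z
early-index {zero} g [] y t () ps qs
early-index {zero} g (c ∷ s) y t () ps qs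
early-index {suc n} g [] y t eq ps qs = zero , λ
  { zero    x≢ z _ → contradiction refl x≢
  ; (suc x) x≢ (suc z) (s≤s l) → AllPairs-tabulate⁻ (g ∘ suc) (subst (AllPairs _≤_) (sym (∷-injectiveʳ eq)) ps) x z l }
early-index {suc n} g (c ∷ s) y t eq (p ∷ ps) (q ∷ qs) with early-index (g ∘ suc) s y t (∷-injectiveʳ eq) ps qs
... | i , ih = suc i , λ
  { zero    _  (suc z) _ → ≤-trans (≤-reflexive (∷-injectiveˡ eq))
      (All.tabulate⁻ (subst (All (c ≤_)) (sym (∷-injectiveʳ eq)) (All.++⁺ (All.++⁻ˡ s p) (q ∷ All.++⁻ʳ s p))) z)
  ; (suc x) x≢ (suc z) (s≤s l) → ih x (x≢ ∘ cong suc) z l }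

-- The membership part serves the induction: it places the letters other than `y` in the sorted
-- list, whose head is then below them.
late-index : ∀ {n} (g : Fin n → ℕ) s y t → tabulate g ≡ s ++ y ∷ t → AllPairs _≤_ (s ++ t) → All (y ≤_) t →
  ∃ λ p → (∀ x → x ≢ p → g x ∈ s ++ t) × (∀ x → x ≢ p → ∀ z → toℕ z < toℕ x → g z ≤ g x)
late-index {zero} g [] y t () ps qs
late-index {zero} g (c ∷ s) y t () ps qs
late-index {suc n} g [] y t eq ps qs = zero , (λ
  { zero    x≢ → contradiction refl x≢
  ; (suc x) _  → subst (g (suc x) ∈_) (∷-injectiveʳ eq) (∈-tabulate⁺ x) }) , λ
  { zero    x≢ z _ → contradiction refl x≢
  ; (suc x) _ zero _ → ≤-trans (≤-reflexive (∷-injectiveˡ eq)) (All.tabulate⁻ (subst (All (y ≤_)) (sym (∷-injectiveʳ eq)) qs) x)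
  ; (suc x) _ (suc z) (s≤s l) → AllPairs-tabulate⁻ (g ∘ suc) (subst (AllPairs _≤_) (sym (∷-injectiveʳ eq)) ps) z x l }
late-index {suc n} g (c ∷ s) y t eq (p ∷ ps) qs with late-index (g ∘ suc) s y t (∷-injectiveʳ eq) ps qs
... | i , mem , ih = suc i , (λ
  { zero    _  → here (∷-injectiveˡ eq)
  ; (suc x) x≢ → there (mem x (x≢ ∘ cong suc)) }) , λ
  { zero    x≢ z ()
  ; (suc x) x≢ zero _ → ≤-trans (≤-reflexive (∷-injectiveˡ eq)) (All.lookup p (mem x (x≢ ∘ cong suc)))
  ; (suc x) x≢ (suc z) (s≤s l) → ih x (x≢ ∘ cong suc) z l }

-- Cycle types excluded by the shapes (n − 1, 1) and (⌈n/2⌉, ⌊n/2⌋)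

single-⊆ : ∀ {n} (g : Fin n → ℕ) k → (g k ∷ []) ⊆ tabulate g
single-⊆ g zero    = refl ∷ minimum _
single-⊆ g (suc k) = g zero ∷ʳ single-⊆ (g ∘ suc) k

pair-⊆ : ∀ {n} (g : Fin n → ℕ) j k → toℕ j < toℕ k → (g j ∷ g k ∷ []) ⊆ tabulate g
pair-⊆ g zero    (suc k) _       = refl ∷ single-⊆ (g ∘ suc) k
pair-⊆ g (suc j) (suc k) (s≤s l) = g zero ∷ʳ pair-⊆ (g ∘ suc) j k l

triple-⊆ : ∀ {n} (g : Fin n → ℕ) i j k → toℕ i < toℕ j → toℕ j < toℕ k → (g i ∷ g j ∷ g k ∷ []) ⊆ tabulate g
triple-⊆ g zero    (suc j) (suc k) _       (s≤s l′) = refl ∷ pair-⊆ (g ∘ suc) j k l′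
triple-⊆ g (suc i) (suc j) (suc k) (s≤s l) (s≤s l′) = g zero ∷ʳ triple-⊆ (g ∘ suc) i j k l l′

module _ {n : ℕ} (σ : Permutation′ n) where
  open Orbit σ
  open CycleType σ

  letter : Fin n → ℕ
  letter i = suc (toℕ (app σ i))

  oneLine≡tabulate : oneLine σ ≡ tabulate letter
  oneLine≡tabulate = map-tabulate id letter

  module _ {p q} (shape : Γ (P (oneLine σ)) ≡ p ∷ q ∷ []) where

    avoids-321 : ∀ i j k → toℕ i < toℕ j → toℕ j < toℕ k →
      toℕ (app σ k) < toℕ (app σ j) → toℕ (app σ j) < toℕ (app σ i) → ⊥
    avoids-321 i j k i<j j<k σk<σj σj<σi = shallow (P (oneLine σ)) shape
      (decreasing⇒deep (s≤s σk<σj) (s≤s σj<σi) []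
        (subst ((letter i ∷ letter j ∷ letter k ∷ []) ⊆_) (sym oneLine≡tabulate) (triple-⊆ letter i j k i<j j<k)) [])
      where
      shallow : ∀ t → Γ t ≡ p ∷ q ∷ [] → ¬ Deep t
      shallow (_ ∷ _ ∷ []) _ ()

    -- Suppose an earlier letter exceeds the fixed one. A smaller letter after `j` would complete a
    -- 321; without one, the positions beyond `j` are mapped among themselves, and the orbit of `i`
    -- could not return.
    before-fixed : ∀ i j → toℕ i < toℕ j → app σ j ≡ j → toℕ (app σ i) < toℕ j
    before-fixed i j i<j fix with <-cmp (toℕ (app σ i)) (toℕ j)
    ... | tri< σi<j _ _ = σi<j
    ... | tri≈ _ eq _   = contradiction (cong toℕ (app-injective (trans (toℕ-injective eq) (sym fix)))) (<⇒≢ i<j)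
    ... | tri> _ _ j<σi with any? (λ k → (toℕ j <? toℕ k) ×-dec (toℕ (app σ k) <? toℕ j))
    ...   | yes (k , j<k , σk<j) = ⊥-elim (avoids-321 i j k i<j j<k
                (subst (λ x → _ < toℕ x) (sym fix) σk<j) (subst (λ x → toℕ x < _) (sym fix) j<σi))
    ...   | no none = contradiction (no-trap (λ z → toℕ j < toℕ z) i j<σi closed) (<-asym i<j)
      where
      closed : ∀ {y} → toℕ j < toℕ y → toℕ j < toℕ (app σ y)
      closed {y} j<y with <-cmp (toℕ (app σ y)) (toℕ j)
      ... | tri< σy<j _ _ = contradiction (y , j<y , σy<j) none
      ... | tri≈ _ eq _   = contradiction (cong toℕ (app-injective (trans (toℕ-injective eq) (sym fix)))) (>⇒≢ j<y)
      ... | tri> _ _ j<σy = j<σy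

    after-fixed : ∀ i j → toℕ i < toℕ j → app σ i ≡ i → toℕ i < toℕ (app σ j)
    after-fixed i j i<j fix with <-cmp (toℕ (app σ j)) (toℕ i)
    ... | tri> _ _ i<σj = i<σj
    ... | tri≈ _ eq _   = contradiction (cong toℕ (app-injective (trans (toℕ-injective eq) (sym fix)))) (>⇒≢ i<j)
    ... | tri< σj<i _ _ with any? (λ k → (toℕ k <? toℕ i) ×-dec (toℕ i <? toℕ (app σ k)))
    ...   | yes (k , k<i , i<σk) = ⊥-elim (avoids-321 k i j k<i i<j
                (subst (λ x → _ < toℕ x) (sym fix) σj<i) (subst (λ x → toℕ x < _) (sym fix) i<σk))
    ...   | no none = contradiction (no-trap (λ z → toℕ z < toℕ i) j σj<i closed) (<-asym i<j)
      where
      closed : ∀ {y} → toℕ y < toℕ i → toℕ (app σ y) < toℕ i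
      closed {y} y<i with <-cmp (toℕ (app σ y)) (toℕ i)
      ... | tri< σy<i _ _ = σy<i
      ... | tri≈ _ eq _   = contradiction (cong toℕ (app-injective (trans (toℕ-injective eq) (sym fix)))) (<⇒≢ y<i)
      ... | tri> _ _ i<σy = contradiction (y , y<i , i<σy) none

    FixedLetter : Pred ℕ 0ℓ
    FixedLetter v = ∃ λ i → app σ i ≡ i × suc (toℕ i) ≡ v

    fixedLetter? : Decidable FixedLetter
    fixedLetter? v = any? λ i → fixed? i ×-dec (suc (toℕ i) ≟ v)

    fixedLetter⇒fixed : ∀ j → FixedLetter (letter j) → app σ j ≡ j
    fixedLetter⇒fixed j (i , fix , eq) with toℕ-injective (suc-injective eq)
    ... | refl = app-injective fix

    open FixedLetters fixedLetter?

    few-fixed-points : q + length (filter fixed? (allFin n)) ≤ p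
    few-fixed-points = ≤-trans (+-monoʳ-≤ q (length-filter-mono fixed? fixedLetter? letter
        (λ {i} fix → i , fix , cong (suc ∘ toℕ) (sym fix)) (allFin n)))
      (two-rows⇒few-flags (subst (AllPairs Compatible) (sym oneLine≡tabulate) (AllPairs.tabulate⁺-< compatible)) shape)
      where
      compatible : ∀ {i j} → toℕ i < toℕ j → Compatible (letter i) (letter j)
      compatible {i} {j} i<j =
        (λ flag → let fix = fixedLetter⇒fixed j flag in s≤s (subst (λ x → _ < toℕ x) (sym fix) (before-fixed i j i<j fix))) ,
        (λ flag → let fix = fixedLetter⇒fixed i flag in s≤s (subst (λ x → toℕ x < _) (sym fix) (after-fixed i j i<j fix)))

  hook⇒monotone-but-one : ∀ {p} → Γ (P (oneLine σ)) ≡ p ∷ 1 ∷ [] →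
    ∃ λ p → (∀ x → x ≢ p → toℕ (app σ x) ≤ toℕ x) ⊎ (∀ x → x ≢ p → toℕ x ≤ toℕ (app σ x))
  hook⇒monotone-but-one shape with almost-sorted (single-bump (oneLine σ) [] [] refl (second-row (P (oneLine σ)) shape))
    where
    second-row : ∀ t {p} → Γ t ≡ p ∷ 1 ∷ [] → cells (below t) ≡ 1
    second-row (r ∷ s ∷ []) eq = trans (+-identityʳ (length s)) (∷-injectiveˡ (∷-injectiveʳ eq))
  ... | early s y t w≡ sorted low with early-index letter s y t (trans (sym oneLine≡tabulate) w≡) sorted low
  -- All positions after `x` hold letters at least that of `x`. If `x` moves up, its orbit is
  -- therefore trapped above `x`.
  ...   | p , le = p , inj₁ λ x x≢p → ≮⇒≥ λ x<σx → <-irrefl refl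
    (no-trap (λ z → toℕ x < toℕ z) x x<σx λ {y} x<y → <-≤-trans x<σx (≤-pred (le x x≢p y x<y)))
  hook⇒monotone-but-one shape | late s y t w≡ sorted high with late-index letter s y t (trans (sym oneLine≡tabulate) w≡) sorted high
  ...   | p , _ , ge = p , inj₂ λ x x≢p → ≮⇒≥ λ σx<x → <-irrefl refl
    (no-trap (λ z → toℕ z < toℕ x) x σx<x λ {y} y<x → ≤-<-trans (≤-pred (ge x x≢p y y<x)) σx<x)

two-row-partition : ∀ {n p q} → q ≤ p → 0 < q → p + q ≡ n → IsPartition n (p ∷ q ∷ [])
two-row-partition {p = p} {q} q≤p 0<q eq = (q≤p ∷ [-]) , (<-≤-trans 0<q q≤p ∷ 0<q ∷ []) ,
  trans (cong (p +_) (+-identityʳ q)) eq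

two-rows≢column : ∀ {n p q} → 3 ≤ n → p ∷ q ∷ [] ≢ replicate n 1
two-rows≢column {n} 3≤n eq = <⇒≢ 3≤n (trans (cong length eq) (length-replicate n))

-- Two shapes suffice: `balanced` allows at most `n % 2` parts equal to 1, and `hook` allows at most
-- one other part.
complete⇒cycleType : ∀ {n μ} → 3 ≤ n → IsPartition n μ → RSKComplete n μ →
  μ ≡ n ∷ [] ⊎ (n % 2 ≡ 1 × μ ≡ (n ∸ 1) ∷ 1 ∷ [])
complete⇒cycleType {n} {μ} 3≤n (sorted , positive , total) complete = conclude μ sorted positive total long ones
  where
  0<n/2 : 0 < n / 2
  0<n/2 = m≥n⇒m/n>0 (≤-trans (s≤s (s≤s z≤n)) 3≤n)

  balanced : ∃ λ σ → HasCycleType σ μ × Γ (P (oneLine σ)) ≡ (n / 2 + n % 2) ∷ n / 2 ∷ []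
  balanced = complete _
    (two-row-partition (m≤m+n (n / 2) (n % 2)) 0<n/2 (sym (trans (m≡m%n+[m/n]*n n 2) (rearrange (n % 2) (n / 2)))))
    (λ ()) (two-rows≢column 3≤n)
    where
    rearrange : ∀ r q → r + q * 2 ≡ q + r + q
    rearrange = solve-∀

  hook : ∃ λ σ → HasCycleType σ μ × Γ (P (oneLine σ)) ≡ (n ∸ 1) ∷ 1 ∷ []
  hook = complete _
    (two-row-partition (∸-monoˡ-≤ 1 (≤-trans (s≤s (s≤s z≤n)) 3≤n)) z<s (m∸n+n≡m (≤-trans (s≤s z≤n) 3≤n)))
    (λ ()) (two-rows≢column 3≤n)

  ones : length (filter (_≟ 1) μ) ≤ n % 2
  ones with balanced
  ... | σ , type , shape = ≤-trans (≤-reflexive (↭-length (filter-↭ (_≟ 1) (↭-sym type))))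
    (≤-trans (CycleType.count-ones σ) (+-cancelˡ-≤ (n / 2) _ _ (few-fixed-points σ shape)))

  long : length (filter (λ k → ¬? (k ≟ 1)) μ) ≤ 1
  long with hook
  ... | σ , type , shape with hook⇒monotone-but-one σ shape
  ...   | p , mono = ≤-trans (≤-reflexive (↭-length (filter-↭ (λ k → ¬? (k ≟ 1)) (↭-sym type))))
    (CycleType.count-nontrivial σ p (CycleType.monotone-but-one σ p mono))

  conclude : ∀ μ → Linked _≥_ μ → All (0 <_) μ → sum μ ≡ n →
    length (filter (λ k → ¬? (k ≟ 1)) μ) ≤ 1 → length (filter (_≟ 1) μ) ≤ n % 2 →
    μ ≡ n ∷ [] ⊎ (n % 2 ≡ 1 × μ ≡ (n ∸ 1) ∷ 1 ∷ [])
  conclude []      _ _ 0≡n _ _ = contradiction (subst (3 ≤_) (sym 0≡n) 3≤n) λ ()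
  conclude (x ∷ []) _ _ x≡n _ _ = inj₁ (cong (_∷ []) (trans (sym (+-identityʳ x)) x≡n))
  conclude (x ∷ y ∷ ks) (y≤x ∷ _) (_ ∷ 0<y ∷ _) total long ones
    with length-filter-partition (_≟ 1) (x ∷ y ∷ ks) | x ≟ 1 | y ≟ 1
  ... | _ | yes refl | yes refl = contradiction (≤-trans ones (≤-pred (m%n<n n 2))) λ { (s≤s ()) }
  ... | _ | yes refl | no y≢1   = contradiction (≤-antisym y≤x 0<y) y≢1
  ... | _ | no x≢1   | no y≢1   = contradiction (subst (_≤ 1) (cong length (trans (filter-accept long? x≢1)
    (cong (x ∷_) (filter-accept long? y≢1)))) long) λ { (s≤s ()) }
    where long? = λ k → ¬? (k ≟ 1)
  conclude (x ∷ y ∷ []) _ _ total long ones | _ | no x≢1 | yes refl =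
    inj₂ (≤-antisym (≤-pred (m%n<n n 2)) (subst (_≤ n % 2) (cong length (filter-reject (_≟ 1) {xs = 1 ∷ []} x≢1)) ones) , cong (_∷ 1 ∷ []) (sym (cong (_∸ 1) (trans (sym total) (+-comm x 1)))))
  conclude (x ∷ y ∷ z ∷ ks) _ _ total long ones | size | no _ | yes refl = contradiction
    (≤-trans (≤-reflexive (sym size)) (+-mono-≤ long (≤-trans ones (≤-pred (m%n<n n 2))))) λ { (s≤s (s≤s ())) }

-- Tableaux with one large entry at the end of each of the first rows

down : ℕ → ℕ → List ℕ
down a zero    = []
down a (suc k) = suc (a + k) ∷ down a k

glue : List (List ℕ) → List ℕ → List (List ℕ)
glue t       []       = t
glue []      (l ∷ ls) = (l ∷ []) ∷ glue [] ls
glue (r ∷ t) (l ∷ ls) = (r ++ l ∷ []) ∷ glue t ls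

addColumn : ℕ → List ℕ → List ℕ
addColumn zero    rs       = rs
addColumn (suc c) []       = 1 ∷ addColumn c []
addColumn (suc c) (r ∷ rs) = suc r ∷ addColumn c rs

Γ-glue : ∀ t ls → Γ (glue t ls) ≡ addColumn (length ls) (Γ t)
Γ-glue t       []       = refl
Γ-glue []      (l ∷ ls) = cong (1 ∷_) (Γ-glue [] ls)
Γ-glue (r ∷ t) (l ∷ ls) = cong₂ _∷_ (trans (length-++ r) (+-comm (length r) 1)) (Γ-glue t ls)

data Ascending : ℕ → List ℕ → Set where
  []  : ∀ {x} → Ascending x []
  _∷_ : ∀ {x y ys} → x < y → Ascending y ys → Ascending x (y ∷ ys)

Bounded : ℕ → List (List ℕ) → Set
Bounded M = All (All (_≤ M))

module _ {q} {Q : Pred ℕ q} where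

  All-insert : ∀ {a} t → Q a → All (All Q) t → All (All Q) (ins t a)
  All-insert []      qa _ = (qa ∷ []) ∷ []
  All-insert {a} (r ∷ t) qa (qr ∷ qt) with rowInsert a r | rowInsert-graph a r
  ... | r′ , nothing | g = All-rowInsert g qa qr ∷ qt
  ... | r′ , just b  | g with replaced g
  ...   | u , _ , refl , refl = All-rowInsert g qa qr ∷ All-insert t (All.head (All.++⁻ʳ u qr)) qt

  All-fold : ∀ w {t} → All Q w → All (All Q) t → All (All Q) (foldl ins t w)
  All-fold []      _         qt = qt
  All-fold (a ∷ w) (qa ∷ qw) qt = All-fold w qw (All-insert _ qa qt)

insert-append : ∀ {a r r′ t} → RowInsert a r r′ nothing → ins (r ∷ t) a ≡ r′ ∷ t
insert-append g rewrite rowInsert-unique g = refl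

insert-bump : ∀ {a b r r′ t} → RowInsert a r r′ (just b) → ins (r ∷ t) a ≡ r′ ∷ ins t b
insert-bump g rewrite rowInsert-unique g = refl

large-append : ∀ {a r} → All (_≤ a) r → RowInsert a r (r ++ a ∷ []) nothing
large-append []       = append
large-append (p ∷ ps) = pass p (large-append ps)

large-bump : ∀ {a r l} → All (_≤ a) r → a < l → RowInsert a (r ++ l ∷ []) (r ++ a ∷ []) (just l)
large-bump []       a<l = bump a<l
large-bump (p ∷ ps) a<l = pass p (large-bump ps a<l)

small-bump : ∀ {a b r r′ l} → RowInsert a r r′ (just b) → RowInsert a (r ++ l ∷ []) (r′ ++ l ∷ []) (just b)
small-bump (bump a<b) = bump a<b
small-bump (pass p g) = pass p (small-bump g)

small-append : ∀ {a r r′ l} → a < l → RowInsert a r r′ nothing → RowInsert a (r ++ l ∷ []) r′ (just l)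
small-append a<l append     = bump a<l
small-append a<l (pass p g) = pass p (small-append a<l g)

-- The letter `y` passes the old entries and takes the place of the large entry of its row, which
-- does the same one row below: the column of large entries shifts down.
glue-large : ∀ {M y} t ls → Bounded M t → M < y → Ascending y ls → ins (glue t ls) y ≡ glue t (y ∷ ls)
glue-large []      []       _        _   _         = refl
glue-large []      (l ∷ ls) _        M<y (y<l ∷ a) =
  trans (insert-bump (bump y<l)) (cong (_ ∷_) (glue-large [] ls [] (<-trans M<y y<l) a))
glue-large (r ∷ t) []       (b ∷ bs) M<y _         = insert-append (large-append (All.map (λ p → ≤-trans p (<⇒≤ M<y)) b))
glue-large (r ∷ t) (l ∷ ls) (b ∷ bs) M<y (y<l ∷ a) =
  trans (insert-bump (large-bump (All.map (λ p → ≤-trans p (<⇒≤ M<y)) b) y<l))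
        (cong (_ ∷_) (glue-large t ls bs (<-trans M<y y<l) a))

-- If the small letter x ends its bumping route in a row with a large entry, that
-- entry is pushed down, and the next large letter y closes the gap.
glue-small-large : ∀ {M x y} t ls → Bounded M t → x ≤ M → M < y → Ascending y ls →
  ins (ins (glue t ls) x) y ≡ glue (ins t x) (y ∷ ls)
glue-small-large t [] bt x≤M M<y _ = glue-large (ins t _) [] (All-insert t x≤M bt) M<y []
glue-small-large {M} {x} {y} [] (l ∷ ls) _ x≤M M<y (y<l ∷ a) = begin
  ins (ins ((l ∷ []) ∷ glue [] ls) x) y   ≡⟨ cong (λ s → ins s y) (insert-bump (bump (≤-<-trans x≤M (<-trans M<y y<l)))) ⟩
  ins ((x ∷ []) ∷ ins (glue [] ls) l) y   ≡⟨ insert-append (pass (≤-trans x≤M (<⇒≤ M<y)) append) ⟩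
  (x ∷ y ∷ []) ∷ ins (glue [] ls) l       ≡⟨ cong (_ ∷_) (glue-large {M} [] ls [] (<-trans M<y y<l) a) ⟩
  (x ∷ y ∷ []) ∷ glue [] (l ∷ ls)         ∎
  where open ≡-Reasoning
glue-small-large {M} {x} {y} (r ∷ t) (l ∷ ls) (b ∷ bs) x≤M M<y (y<l ∷ a) with rowInsert x r | rowInsert-graph x r
... | r′ , nothing | g = begin
  ins (ins ((r ++ l ∷ []) ∷ glue t ls) x) y   ≡⟨ cong (λ s → ins s y) (insert-bump (small-append (≤-<-trans x≤M (<-trans M<y y<l)) g)) ⟩
  ins (r′ ∷ ins (glue t ls) l) y              ≡⟨ insert-append (large-append (All.map (λ p → ≤-trans p (<⇒≤ M<y)) (All-rowInsert g x≤M b))) ⟩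
  (r′ ++ y ∷ []) ∷ ins (glue t ls) l          ≡⟨ cong (_ ∷_) (glue-large t ls bs (<-trans M<y y<l) a) ⟩
  (r′ ++ y ∷ []) ∷ glue t (l ∷ ls)            ∎
  where open ≡-Reasoning
... | r′ , just c | g with replaced g
...   | u , v , r≡ , _ = begin
  ins (ins ((r ++ l ∷ []) ∷ glue t ls) x) y         ≡⟨ cong (λ s → ins s y) (insert-bump (small-bump g)) ⟩
  ins ((r′ ++ l ∷ []) ∷ ins (glue t ls) c) y        ≡⟨ insert-bump (large-bump (All.map (λ p → ≤-trans p (<⇒≤ M<y)) (All-rowInsert g x≤M b)) y<l) ⟩
  (r′ ++ y ∷ []) ∷ ins (ins (glue t ls) c) l        ≡⟨ cong (_ ∷_) (glue-small-large t ls bs c≤M (<-trans M<y y<l) a) ⟩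
  (r′ ++ y ∷ []) ∷ glue (ins t c) (l ∷ ls)          ∎
  where
  open ≡-Reasoning
  c≤M : c ≤ M
  c≤M = All.head (All.++⁻ʳ u (subst (All (_≤ M)) r≡ b))

ascending-down : ∀ {a} k {ls} → Ascending (a + k) ls → Ascending a (down a k ʳ++ ls)
ascending-down {a} zero    asc = subst (λ b → Ascending b _) (+-identityʳ a) asc
ascending-down {a} (suc k) {ls} asc = ascending-down k (n<1+n (a + k) ∷ subst (λ b → Ascending b ls) (+-suc a k) asc)

-- Each letter of the decreasing run pushes the earlier ones down by a row, so the run appears
-- reversed on top of `ls`.
fold-down : ∀ {M a} t k ls → Bounded M t → M ≤ a → Ascending (a + k) ls →
  foldl ins (glue t ls) (down a k) ≡ glue t (down a k ʳ++ ls)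
fold-down t zero    ls bt M≤a asc = refl
fold-down {a = a} t (suc k) ls bt M≤a asc with subst (λ b → Ascending b ls) (+-suc a k) asc
... | asc′ = trans (cong (λ s → foldl ins s (down a k)) (glue-large t ls bt (s≤s (≤-trans M≤a (m≤m+n a k))) asc′))
  (fold-down t k _ bt M≤a (n<1+n (a + k) ∷ asc′))

length-down : ∀ a k → length (down a k) ≡ k
length-down a zero    = refl
length-down a (suc k) = cong suc (length-down a k)

down-last : ∀ a k ls → ∃ λ ls′ → down a (suc k) ʳ++ ls ≡ suc a ∷ ls′
down-last a zero    ls = ls , cong (λ b → suc b ∷ ls) (+-identityʳ a)
down-last a (suc k) ls = down-last a k _

-- The run M + e + k, ..., M + 1 with `x` inserted after its first `k` letters.
block : ℕ → ℕ → ℕ → ℕ → List ℕ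
block M k e x = down (M + e) k ++ x ∷ down M e

blockColumn : ℕ → ℕ → ℕ → List ℕ → List ℕ
blockColumn M k e ls = down M e ʳ++ (down (M + e) k ʳ++ ls)

-- The run after `x` is nonempty because its first letter has to close the gap that `x` may leave
-- among the large entries.
fold-block : ∀ {M} t k e x ls → Bounded M t → x ≤ M → Ascending (M + suc e + k) ls →
  foldl ins (glue t ls) (block M k (suc e) x) ≡ glue (ins t x) (blockColumn M k (suc e) ls)
fold-block {M} t k e x ls bt x≤M asc = begin
  foldl ins (glue t ls) (down (M + suc e) k ++ x ∷ down M (suc e))
    ≡⟨ foldl-++ ins (glue t ls) (down (M + suc e) k) (x ∷ down M (suc e)) ⟩
  foldl ins (foldl ins (glue t ls) (down (M + suc e) k)) (x ∷ down M (suc e))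
    ≡⟨ cong (λ s → foldl ins s (x ∷ down M (suc e))) (fold-down t k ls bt (m≤m+n M (suc e)) asc) ⟩
  foldl ins (ins (ins (glue t ls′) x) (suc (M + e))) (down M e)
    ≡⟨ cong (λ s → foldl ins s (down M e)) (glue-small-large t ls′ bt x≤M (s≤s (m≤m+n M e)) asc′) ⟩
  foldl ins (glue (ins t x) (suc (M + e) ∷ ls′)) (down M e)
    ≡⟨ fold-down (ins t x) e _ (All-insert t x≤M bt) ≤-refl (n<1+n (M + e) ∷ asc′) ⟩
  glue (ins t x) (down M (suc e) ʳ++ ls′) ∎
  where
  open ≡-Reasoning
  ls′ = down (M + suc e) k ʳ++ ls
  asc′ : Ascending (suc (M + e)) ls′
  asc′ = subst (λ b → Ascending b ls′) (+-suc M e) (ascending-down k asc)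

length-blockColumn : ∀ M k e ls → length (blockColumn M k e ls) ≡ e + (k + length ls)
length-blockColumn M k e ls = begin
  length (down M e ʳ++ (down (M + e) k ʳ++ ls))   ≡⟨ length-ʳ++ (down M e) ⟩
  length (down M e) + length (down (M + e) k ʳ++ ls)
    ≡⟨ cong₂ _+_ (length-down M e) (trans (length-ʳ++ (down (M + e) k)) (cong (_+ length ls) (length-down (M + e) k))) ⟩
  e + (k + length ls) ∎
  where open ≡-Reasoning

-- The first column is nonempty, so a smaller letter bumps its top entry and `N` keeps its place in
-- the first row.
fold-column : ∀ {a N} k {c} cs → Ascending (a + k) (c ∷ cs) →
  foldl ins (glue (glue [] (c ∷ cs)) (N ∷ [])) (down a k) ≡ glue (glue [] (down a k ʳ++ (c ∷ cs))) (N ∷ [])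
fold-column zero    cs asc = refl
fold-column {a} {N} (suc k) {c} cs asc with subst (λ b → Ascending b (c ∷ cs)) (+-suc a k) asc
... | x<c ∷ asc′ = trans
  (cong (λ s → foldl ins s (down a k))
    (trans (insert-bump (bump x<c)) (cong (_ ∷_) (glue-large {0} [] cs [] (≤-<-trans z≤n x<c) asc′))))
  (fold-column k (c ∷ cs) (n<1+n (a + k) ∷ x<c ∷ asc′))

glue-top : ∀ {M y} t ls → Bounded M t → M ≤ y → ∃₂ λ r rs → glue t (y ∷ ls) ≡ r ∷ rs × All (_≤ y) r
glue-top []      ls _        M≤y = _ , _ , refl , ≤-refl ∷ []
glue-top (r ∷ t) ls (b ∷ bs) M≤y = _ , _ , refl , All.++⁺ (All.map (λ p → ≤-trans p M≤y) b) (≤-refl ∷ [])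

-- Cyclic words

-- Positions are counted from 1, as letters are.
data At : List ℕ → ℕ → ℕ → Set where
  here  : ∀ {v w} → At (v ∷ w) 1 v
  there : ∀ {x i v w} → At w i v → At (x ∷ w) (suc i) v

Reach : List ℕ → ℕ → ℕ → Set
Reach w = TransClosure (At w)

At-++ˡ : ∀ {w w′ i v} → At w i v → At (w ++ w′) i v
At-++ˡ here      = here
At-++ˡ (there p) = there (At-++ˡ p)

At-++ʳ : ∀ u {w i v} → At w i v → At (u ++ w) (length u + i) v
At-++ʳ []      p = p
At-++ʳ (x ∷ u) p = there (At-++ʳ u p)

At-middle : ∀ u {x w} → At (u ++ x ∷ w) (suc (length u)) x
At-middle []      = here
At-middle (y ∷ u) = there (At-middle u)

At-snoc⁻ : ∀ u {x i v} → At (u ++ x ∷ []) i v → At u i v ⊎ (i ≡ suc (length u) × v ≡ x)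
At-snoc⁻ []      here      = inj₂ (refl , refl)
At-snoc⁻ (y ∷ u) here      = inj₁ here
At-snoc⁻ (y ∷ u) (there p) = Data.Sum.map there (Data.Product.map₁ (cong suc)) (At-snoc⁻ u p)

At-down : ∀ a k {i v} → 0 < i → a < v → i + v ≡ suc (a + k) → At (down a k) i v
At-down a zero    {i} {v} 0<i a<v eq =
  contradiction (≤-trans (+-mono-≤ 0<i a<v) (≤-reflexive (trans eq (cong suc (+-identityʳ a))))) 1+n≰n
At-down a (suc k) {suc zero}    0<i a<v eq rewrite trans (suc-injective eq) (+-suc a k) = here
At-down a (suc k) {suc (suc i)} 0<i a<v eq =
  there (At-down a k z<s a<v (suc-injective (trans eq (cong suc (+-suc a k)))))

-- The permutation of positions q + 1, q + 2, … that starts with the reversal and has x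
-- at position q + k + 1 runs through q + 1, its mirror image, q + 2, its mirror image, …
-- and reaches x last.
module Zigzag (w : List ℕ) (q k e δ x : ℕ) (δ≤1 : δ ≤ 1) (k≤δ+e : k ≤ δ + e)
  (embed : ∀ {i v} → At (block (δ + q) k e x) i v → At w (q + i) v) where

  -- When `δ` is 1 the letter `q + 1` is missing from the block. Relative to `q`, position and
  -- letter add up to `k + δ + e + 1` before `x`; after `x`, counting positions from `x`, the sum is
  -- `δ + e + 1`.
  lower : ∀ i j → 0 < i → i ≤ k → i + j ≡ suc (k + (δ + e)) → At w (q + i) (q + j)
  lower i j 0<i i≤k eq = embed (At-++ˡ (At-down (δ + q + e) k 0<i big sum≡))
    where
    open ≡-Reasoning
    sum≡ : i + (q + j) ≡ suc (δ + q + e + k)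
    sum≡ = begin
      i + (q + j)             ≡⟨ shuffle i q j ⟩
      q + (i + j)             ≡⟨ cong (q +_) eq ⟩
      q + suc (k + (δ + e))   ≡⟨ shuffle′ q k δ e ⟩
      suc (δ + q + e + k)     ∎
      where
      shuffle : ∀ i q j → i + (q + j) ≡ q + (i + j)
      shuffle = solve-∀
      shuffle′ : ∀ q k δ e → q + suc (k + (δ + e)) ≡ suc (δ + q + e + k)
      shuffle′ = solve-∀

    big : δ + q + e < q + j
    big = +-cancelˡ-≤ k (suc (δ + q + e)) (q + j) (≤-trans (≤-reflexive (trans (+-suc k _) (cong suc (+-comm k _))))
      (≤-trans (≤-reflexive (sym sum≡)) (+-monoˡ-≤ (q + j) i≤k)))

  middle : At w (q + suc k) x
  middle = embed (subst (λ i → At (block (δ + q) k e x) i x) (cong suc (length-down (δ + q + e) k)) (At-middle (down (δ + q + e) k)))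

  upper : ∀ t j → 0 < t → t ≤ e → t + j ≡ suc (δ + e) → At w (q + (suc k + t)) (q + j)
  upper t j 0<t t≤e eq = embed (subst (λ i → At (block (δ + q) k e x) i (q + j))
      (trans (cong (_+ suc t) (length-down (δ + q + e) k)) (+-suc k t))
      (At-++ʳ (down (δ + q + e) k) (there (At-down (δ + q) e 0<t big sum≡))))
    where
    sum≡ : t + (q + j) ≡ suc (δ + q + e)
    sum≡ = trans (shuffle t q j) (trans (cong (q +_) eq) (shuffle′ q δ e))
      where
      shuffle : ∀ i q j → i + (q + j) ≡ q + (i + j)
      shuffle = solve-∀
      shuffle′ : ∀ q δ e → q + suc (δ + e) ≡ suc (δ + q + e)
      shuffle′ = solve-∀

    big : δ + q < q + j
    big = +-cancelˡ-≤ e (suc (δ + q)) (q + j) (≤-trans (≤-reflexive (trans (+-suc e _) (cong suc (+-comm e _))))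
      (≤-trans (≤-reflexive (sym sum≡)) (+-monoˡ-≤ (q + j) t≤e)))

  module _ (R : Pred ℕ 0ℓ) (closed : ∀ {i v} → At w i v → R i → R v) (start : R (q + 1)) where

    mirror : ∀ i t → 0 < i → i ≤ k → t + i ≡ δ + e → R (q + i) → R (q + (suc k + t))
    mirror i t 0<i i≤k eq = closed (lower i (suc k + t) 0<i i≤k (trans (shuffle i k t) (cong (λ s → suc (k + s)) eq)))
      where
      shuffle : ∀ i k t → i + (suc k + t) ≡ suc (k + (t + i))
      shuffle = solve-∀

    -- Position `q + i` leads to its mirror image beyond `x`, and this leads to `q + i + 1`. If the
    -- mirror image is the position of `x`, it already is `q + i + 1`.
    reach-lower : ∀ i → i ≤ k → R (q + suc i)
    reach-lower zero    _    = start
    reach-lower (suc i) si≤k with δ + e ∸ suc i | m∸n+n≡m {δ + e} {suc i} (≤-trans si≤k k≤δ+e)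
    ... | zero  | eq = subst (λ s → R (q + s))
      (trans (+-identityʳ (suc k)) (cong suc (≤-antisym (≤-trans k≤δ+e (≤-reflexive (sym eq))) si≤k)))
      (mirror (suc i) 0 z<s si≤k eq (reach-lower i (<⇒≤ si≤k)))
    ... | suc t | eq = closed (upper (suc t) (suc (suc i)) z<s st≤e (trans (+-suc (suc t) (suc i)) (cong suc eq)))
      (mirror (suc i) (suc t) z<s si≤k eq (reach-lower i (<⇒≤ si≤k)))
      where
      st≤e : suc t ≤ e
      st≤e = +-cancelʳ-≤ (suc i) (suc t) e (≤-trans (≤-reflexive eq)
        (≤-trans (≤-reflexive (+-comm δ e)) (+-monoʳ-≤ e (≤-trans δ≤1 (s≤s z≤n)))))

    reach-upper : ∀ i t → i < k → t + suc i ≡ δ + e → R (q + (suc k + t))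
    reach-upper i t i<k eq = mirror (suc i) t z<s i<k eq (reach-lower i (<⇒≤ i<k))

    -- Either every position after `x` is within range of the zigzag, or `δ + e` is `k + 2` and
    -- position `q + k + 2`, which holds its own number, is left out.
    Misses : ℕ → Set
    Misses j = δ + e ≤ suc k ⊎ (δ + e ≡ suc (suc k) × j ≢ suc (suc k))

    -- For `δ` equal to 0 the number of the last position is larger than all new letters of the
    -- block, so its reachability is supplied from outside as `end`.
    cover-upper : (δ ≡ 0 → R (q + (suc k + e))) → ∀ t → 0 < t → t ≤ e → Misses (suc k + t) → R (q + (suc k + t))
    cover-upper end t 0<t t≤e full with δ + e ∸ t | m+[n∸m]≡n {t} {δ + e} (≤-trans t≤e (m≤n+m e δ))
    ... | zero  | eq = subst (λ s → R (q + (suc k + s))) e≡t (end δ≡0)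
      where
      t≡δ+e : t ≡ δ + e
      t≡δ+e = trans (sym (+-identityʳ t)) eq
      δ≡0 : δ ≡ 0
      δ≡0 = n≤0⇒n≡0 (+-cancelʳ-≤ e δ 0 (≤-trans (≤-reflexive (sym t≡δ+e)) t≤e))
      e≡t : e ≡ t
      e≡t = sym (trans t≡δ+e (cong (_+ e) δ≡0))
    ... | suc i | eq = reach-upper i t (bound t 0<t full eq) eq
      where
      bound : ∀ t → 0 < t → Misses (suc k + t) → t + suc i ≡ δ + e → i < k
      bound (suc t)       _ (inj₁ δe≤)       eq = ≤-pred (≤-trans (≤-trans (s≤s (m≤n+m (suc i) t)) (≤-reflexive eq)) δe≤)
      bound (suc zero)    _ (inj₂ (_ , j≢))  eq = contradiction (+-comm (suc k) 1) j≢
      bound (suc (suc t)) _ (inj₂ (δe≡ , _)) eq =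
        ≤-pred (≤-pred (≤-trans (s≤s (s≤s (m≤n+m (suc i) t))) (≤-reflexive (trans eq δe≡))))

    cover : (δ ≡ 0 → R (q + (suc k + e))) → ∀ j → 0 < j → j ≤ suc k + e → Misses j → R (q + j)
    cover end j 0<j j≤ full with j ≤? suc k
    cover end (suc j) 0<j j≤ full | yes j≤k = reach-lower j (≤-pred j≤k)
    cover end j 0<j j≤ full | no j≰k = subst (λ s → R (q + s)) j≡
      (cover-upper end (j ∸ suc k) (m<n⇒0<n∸m (≰⇒> j≰k))
        (+-cancelˡ-≤ (suc k) _ e (≤-trans (≤-reflexive j≡) j≤)) (subst Misses (sym j≡) full))
      where
      j≡ : suc k + (j ∸ suc k) ≡ j
      j≡ = m+[n∸m]≡n (<⇒≤ (≰⇒> j≰k))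

InRange : ℕ → ℕ → Set
InRange n x = 0 < x × x ≤ n

range-weaken : ∀ {m n x} → m ≤ n → InRange m x → InRange n x
range-weaken m≤n (0<x , x≤m) = 0<x , ≤-trans x≤m m≤n

-- φ = 0 encodes that there is no exceptional position.
Exception : Bool → ℕ → List ℕ → Set
Exception false φ w = φ ≡ 0
Exception true  φ w = 1 < φ × At w φ φ

-- Since `Reach` takes at least one step and `φ` is never 1, the case `i = 1` of `reach` says that
-- the cycle closes.
record Cyclic (b : Bool) (w : List ℕ) : Set where
  constructor cyclic
  field
    φ         : ℕ
    φ≤length  : φ ≤ length w
    exception : Exception b φ w
    reach     : ∀ i → InRange (length w) i → i ≢ φ → Reach w 1 i

record Word (b : Bool) (shape : List ℕ) : Set where
  constructor word
  field
    letters  : List ℕ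
    range    : All (InRange (length letters)) letters
    P-shape  : Γ (P letters) ≡ shape
    isCyclic : Cyclic b letters

-- A word whose largest letter n may be replaced by any N ≥ n: it is not in the first row of P.
record Tower (b : Bool) (shape : List ℕ) : Set where
  constructor tower
  field
    n        : ℕ
    u v      : List ℕ
    size     : length (u ++ n ∷ v) ≡ n
    rangeᵘ   : All (InRange n) u
    rangeᵛ   : All (InRange n) v
    P-shape  : ∀ N → n ≤ N → ∃₂ λ r rs → P (u ++ N ∷ v) ≡ r ∷ rs × All (_< n) r × Γ (r ∷ rs) ≡ shape
    isCyclic : Cyclic b (u ++ n ∷ v)
    φ<n      : Cyclic.φ isCyclic < n

-- Adding columns to cyclic words

size-positive : ∀ u n v → length (u ++ n ∷ v) ≡ n → 0 < n
size-positive u n v size = subst (0 <_) size (subst (0 <_) (sym (length-++-suc u)) z<s)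
  where
  length-++-suc : ∀ u → length (u ++ n ∷ v) ≡ suc (length (u ++ v))
  length-++-suc []      = refl
  length-++-suc (x ∷ u) = cong suc (length-++-suc u)

toWord : ∀ {b shape} → Tower b shape → Word b shape
toWord (tower n u v size ru rv shape cyc φ<n) = let r , rs , eq , _ , Γ≡ = shape n ≤-refl in word (u ++ n ∷ v)
  (subst (λ m → All (InRange m) (u ++ n ∷ v)) (sym size) (All.++⁺ ru ((size-positive u n v size , ≤-refl) ∷ rv)))
  (trans (cong Γ eq) Γ≡) cyc

Exception-map : ∀ b {φ w w′} → (At w φ φ → At w′ φ φ) → Exception b φ w → Exception b φ w′
Exception-map false f eq       = eq
Exception-map true  f (l , at) = l , f at

reach-map : ∀ {w w′} → (∀ {i v} → At w i v → Reach w′ i v) → ∀ {i v} → Reach w i v → Reach w′ i v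
reach-map f [ at ]     = f at
reach-map f (at ∷ ats) = f at Closure.++ reach-map f ats

At-functional : ∀ {w i x y} → At w i x → At w i y → x ≡ y
At-functional here      here      = refl
At-functional (there p) (there q) = At-functional p q

-- Enlarging `n` to `n + 1` leaves only entries below `n` in the first row, so a final `n` extends
-- that row. In the cycle, the step to `n` becomes a step to `n + 1` followed by one to `n`.
addOne : ∀ {b shape} → Tower b shape → Tower b (addColumn 1 shape)
addOne {b} (tower n u v size ru rv shape (cyclic φ _ exc reach) φ<n) = tower (suc n) u (v ++ n ∷ [])
  size′ (All.map (range-weaken (n≤1+n n)) ru)
  (All.++⁺ (All.map (range-weaken (n≤1+n n)) rv) ((size-positive u n v size , n≤1+n n) ∷ []))
  shape′ (cyclic φ (subst (φ ≤_) (sym size′) (m≤n⇒m≤1+n (<⇒≤ φ<n))) (Exception-map b keep-fixed exc) reach′) (m<n⇒m<1+n φ<n)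
  where
  w w′ : List ℕ
  w  = u ++ n ∷ v
  w′ = u ++ suc n ∷ v ++ n ∷ []

  snoc : ∀ N → u ++ N ∷ v ++ n ∷ [] ≡ (u ++ N ∷ v) ++ n ∷ []
  snoc N = sym (++-assoc u (N ∷ v) (n ∷ []))

  length-snoc : ∀ N → length ((u ++ N ∷ v) ++ n ∷ []) ≡ suc (length (u ++ N ∷ v))
  length-snoc N = trans (length-++ (u ++ N ∷ v)) (+-comm _ 1)

  same-length : ∀ N N′ → length (u ++ N ∷ v) ≡ length (u ++ N′ ∷ v)
  same-length N N′ = trans (length-++ u) (sym (length-++ u))

  size′ : length w′ ≡ suc n
  size′ = trans (cong length (snoc (suc n))) (trans (length-snoc (suc n)) (cong suc (trans (same-length (suc n) n) size)))

  shape′ : ∀ N → suc n ≤ N → ∃₂ λ r rs → P (u ++ N ∷ v ++ n ∷ []) ≡ r ∷ rs × All (_< suc n) r × Γ (r ∷ rs) ≡ _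
  shape′ N n<N with shape N (<⇒≤ n<N)
  ... | r , rs , eq , r<n , refl = r ++ n ∷ [] , rs ,
    (begin
      P (u ++ N ∷ v ++ n ∷ [])              ≡⟨ cong P (snoc N) ⟩
      P ((u ++ N ∷ v) ++ n ∷ [])            ≡⟨ foldl-++ ins [] (u ++ N ∷ v) (n ∷ []) ⟩
      ins (P (u ++ N ∷ v)) n                ≡⟨ cong (λ t → ins t n) eq ⟩
      ins (r ∷ rs) n                        ≡⟨ insert-append (large-append (All.map <⇒≤ r<n)) ⟩
      (r ++ n ∷ []) ∷ rs                    ∎) ,
    All.++⁺ (All.map m<n⇒m<1+n r<n) (n<1+n n ∷ []) ,
    cong (_∷ Γ rs) (trans (length-++ r) (+-comm _ 1))
    where open ≡-Reasoning

  last-at : At w′ (suc n) n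
  last-at = subst₂ (λ z i → At z i n) (sym (snoc (suc n))) (cong suc (trans (same-length (suc n) n) size)) (At-middle (u ++ suc n ∷ v))

  step : ∀ {i x} → At w i x → At w′ i x ⊎ x ≡ n × At w′ i (suc n)
  step = go u
    where
    go : ∀ u {i x} → At (u ++ n ∷ v) i x → At (u ++ suc n ∷ v ++ n ∷ []) i x ⊎ x ≡ n × At (u ++ suc n ∷ v ++ n ∷ []) i (suc n)
    go []      here      = inj₂ (refl , here)
    go []      (there p) = inj₁ (there (At-++ˡ p))
    go (y ∷ u) here      = inj₁ here
    go (y ∷ u) (there p) = Data.Sum.map there (Data.Product.map₂ there) (go u p)

  follow : ∀ {i x} → At w i x → Reach w′ i x
  follow at with step at
  ... | inj₁ at′          = [ at′ ]
  ... | inj₂ (refl , at′) = at′ ∷ [ last-at ]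

  keep-fixed : At w φ φ → At w′ φ φ
  keep-fixed at with step at
  ... | inj₁ at′        = at′
  ... | inj₂ (refl , _) = contradiction φ<n (<-irrefl refl)

  max-moved : ∀ b → Exception b φ w → suc (length u) ≢ φ
  max-moved false refl     ()
  max-moved true  (_ , at) refl = <-irrefl (At-functional at (At-middle u)) φ<n

  reach-n : Reach w′ 1 (suc n)
  reach-n = reach-map follow (reach (suc (length u)) (z<s , u<length) (max-moved b exc)) Closure.∷ʳ At-middle u
    where
    u<length : suc (length u) ≤ length w
    u<length = ≤-trans (s≤s (m≤m+n (length u) (length v))) (≤-reflexive (sym (trans (length-++ u) (+-suc (length u) _))))

  reach′ : ∀ i → InRange (length w′) i → i ≢ φ → Reach w′ 1 i
  reach′ i (0<i , i≤) i≢φ with m≤n⇒m<n∨m≡n (subst (i ≤_) size′ i≤)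
  ... | inj₁ i≤n  = reach-map follow (reach i (0<i , subst (i ≤_) (sym size) (≤-pred i≤n)) i≢φ)
  ... | inj₂ refl = reach-n

All-ʳ++ : ∀ {q} {Q : Pred ℕ q} xs {ys} → All Q xs → All Q ys → All Q (xs ʳ++ ys)
All-ʳ++ []       _        qys = qys
All-ʳ++ (x ∷ xs) (q ∷ qs) qys = All-ʳ++ xs qs (q ∷ qys)

All-down : ∀ {n} a k → a + k ≤ n → All (InRange n) (down a k)
All-down a zero    _  = []
All-down {n} a (suc k) le = (z<s , subst (_≤ n) (+-suc a k) le) ∷ All-down a k (≤-trans (+-monoʳ-≤ a (n≤1+n k)) le)

length-block : ∀ M k e x → length (block M k e x) ≡ k + suc e
length-block M k e x = trans (length-++ (down (M + e) k)) (cong₂ (λ a b → a + suc b) (length-down (M + e) k) (length-down M e))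

column-bounded : ∀ {M cs} → All (_≤ M) cs → Bounded M (glue [] cs)
column-bounded []       = []
column-bounded (p ∷ ps) = (p ∷ []) ∷ column-bounded ps

-- Let w = u x be a cyclic word of length M. In u N (M+c−1) … x … (M+1) the cycle of w
-- is cut after M, and the new positions are inserted there in zigzag order.
addLongColumn : ∀ {b shape} k e → k ≤ suc e → suc e ≤ suc k → (w : Word b shape) →
  Cyclic.φ (Word.isCyclic w) < length (Word.letters w) → Tower b (addColumn (suc k + suc e) shape)
addLongColumn {b} {shape} k e′ k≤e e≤k (word w range Γ≡ (cyclic φ _ exc reach)) φ< with initLast w
... | [] = contradiction φ< λ ()
... | u ∷ʳ′ x = tower n u (block M k e x) size (All.map (range-weaken M≤n ∘ subst (λ m → InRange m _) |w|≡M) (All.++⁻ˡ u range))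
    (All.++⁺ (All-down (M + e) k e+k) (range-weaken M≤n (subst (λ m → InRange m x) |w|≡M (All.head (All.++⁻ʳ u range)))
      ∷ All-down M e (≤-trans (m≤m+n (M + e) k) e+k)))
    P-shape′ (cyclic φ (subst (φ ≤_) (sym size) (<⇒≤ φ<n)) (Exception-map b keep-fixed exc) reach′) φ<n
  where
  e M n : ℕ
  e = suc e′
  M = suc (length u)
  n = M + (suc k + e)

  w′ : List ℕ
  w′ = u ++ n ∷ block M k e x

  |w|≡M : length (u ++ x ∷ []) ≡ M
  |w|≡M = trans (length-++ u) (+-comm _ 1)

  φ<M : φ < M
  φ<M = subst (φ <_) |w|≡M φ<

  M≤n : M ≤ n
  M≤n = m≤m+n M _

  φ<n : φ < n
  φ<n = <-≤-trans φ<M M≤n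

  e+k : M + e + k ≤ n
  e+k = ≤-trans (≤-reflexive (trans (+-assoc M e k) (cong (M +_) (+-comm e k)))) (+-monoʳ-≤ M (n≤1+n (k + e)))

  size : length w′ ≡ n
  size = trans (length-++ u) (trans (cong (λ l → length u + suc l) (length-block M k e x)) (shuffle (length u) k e))
    where
    shuffle : ∀ a k e → a + suc (k + suc e) ≡ suc a + (suc k + e)
    shuffle = solve-∀

  P-shape′ : ∀ N → n ≤ N → ∃₂ λ r rs → P (u ++ N ∷ block M k e x) ≡ r ∷ rs × All (_< n) r × Γ (r ∷ rs) ≡ addColumn (suc k + e) shape
  -- The new column has `M + 1` at its top, so `N` is not in the first row and all entries there are
  -- below `n`.
  P-shape′ N n≤N with down-last M e′ (down (M + e) k ʳ++ (N ∷ []))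
  ... | ls , col≡ with glue-top (ins (P u) x) ls bounded′ (n≤1+n M)
    where
    bounded′ : Bounded M (ins (P u) x)
    bounded′ = subst (λ t → Bounded M t) (foldl-++ ins [] u (x ∷ []))
      (All-fold (u ++ x ∷ []) (subst (λ m → All (_≤ m) (u ++ x ∷ [])) |w|≡M (All.map proj₂ range)) [])
  ...   | r , rs , top≡ , r≤ = r , rs , eq , All.map (λ p → ≤-<-trans p M+1<n) r≤ , (begin
      Γ (r ∷ rs)                                                ≡⟨ cong Γ (sym (trans (cong (glue (ins (P u) x)) col≡) top≡)) ⟩
      Γ (glue (ins (P u) x) (blockColumn M k e (N ∷ [])))       ≡⟨ Γ-glue (ins (P u) x) (blockColumn M k e (N ∷ [])) ⟩
      addColumn (length (blockColumn M k e (N ∷ []))) (Γ (ins (P u) x))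
        ≡⟨ cong₂ addColumn (trans (length-blockColumn M k e (N ∷ [])) (shuffle e k)) (trans (cong Γ (sym (foldl-++ ins [] u (x ∷ [])))) Γ≡) ⟩
      addColumn (suc k + e) shape                               ∎)
    where
    open ≡-Reasoning
    shuffle : ∀ e k → e + (k + 1) ≡ suc k + e
    shuffle = solve-∀

    M+1<n : suc M < n
    M+1<n = ≤-trans (≤-reflexive (+-comm 2 M)) (+-monoʳ-≤ M (s≤s (≤-trans (s≤s z≤n) (m≤n+m e k))))

    bounded : Bounded M (P u)
    bounded = All-fold u (subst (λ m → All (_≤ m) u) |w|≡M (All.map proj₂ (All.++⁻ˡ u range))) []

    eq : P (u ++ N ∷ block M k e x) ≡ r ∷ rs
    eq = begin
      P (u ++ N ∷ block M k e x)                              ≡⟨ foldl-++ ins [] u (N ∷ block M k e x) ⟩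
      foldl ins (ins (P u) N) (block M k e x)                 ≡⟨ cong (λ t → foldl ins t (block M k e x))
                                                                   (glue-large (P u) [] bounded (<-≤-trans (s≤s (m≤n+m M (k + e))) (≤-trans (≤-reflexive (shuffle′ M k e)) n≤N)) []) ⟩
      foldl ins (glue (P u) (N ∷ [])) (block M k e x)         ≡⟨ fold-block (P u) k e′ x (N ∷ []) bounded x≤M (asc ∷ []) ⟩
      glue (ins (P u) x) (blockColumn M k e (N ∷ []))         ≡⟨ cong (glue (ins (P u) x)) col≡ ⟩
      glue (ins (P u) x) (suc M ∷ ls)                         ≡⟨ top≡ ⟩
      r ∷ rs                                                  ∎
      where
      shuffle′ : ∀ M k e → suc (k + e + M) ≡ M + (suc k + e)
      shuffle′ = solve-∀
      shuffle″ : ∀ M k e → suc (M + e + k) ≡ M + (suc k + e)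
      shuffle″ = solve-∀
      x≤M : x ≤ M
      x≤M = subst (x ≤_) |w|≡M (proj₂ (All.head (All.++⁻ʳ u range)))
      asc : M + e + k < N
      asc = ≤-trans (≤-reflexive (shuffle″ M k e)) n≤N

  open Zigzag w′ M k e 0 x z≤n k≤e
    (λ {i} {v} p → subst (λ j → At w′ j v) (+-suc (length u) i) (At-++ʳ u (there p)))

  first : Reach w′ M (M + 1)
  -- Position `M` holds `n`, and position `n` holds the last letter of the block, `M + 1`.
  first = At-middle u ∷ [ upper e 1 z<s ≤-refl (+-comm e 1) ]

  closed : ∀ {i v} → At w′ i v → Reach w′ M i → Reach w′ M v
  closed at p = p Closure.∷ʳ at

  follow : ∀ {i v} → At (u ++ x ∷ []) i v → Reach w′ i v
  follow at with At-snoc⁻ u at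
  ... | inj₁ at′           = [ At-++ˡ at′ ]
  -- The old step from `M` to `x` is replaced by the detour through the zigzag, which ends in `x`.
  ... | inj₂ (refl , refl) = closed middle (reach-lower (Reach w′ M) closed first k ≤-refl)

  keep-fixed : At (u ++ x ∷ []) φ φ → At w′ φ φ
  keep-fixed at with At-snoc⁻ u at
  ... | inj₁ at′      = At-++ˡ at′
  ... | inj₂ (eq , _) = contradiction eq (<⇒≢ φ<M)

  reach′ : ∀ i → InRange (length w′) i → i ≢ φ → Reach w′ 1 i
  reach′ i (0<i , i≤) i≢φ with i ≤? M
  ... | yes i≤M = reach-map follow (reach i (0<i , subst (i ≤_) (sym |w|≡M) i≤M) i≢φ)
  ... | no i≰M = reach-map follow (reach M (z<s , ≤-reflexive (sym |w|≡M)) (>⇒≢ φ<M)) Closure.++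
    subst (Reach w′ M) i≡ (cover (Reach w′ M) closed first (λ _ → [ At-middle u ]) (i ∸ M) (m<n⇒0<n∸m (≰⇒> i≰M))
      (+-cancelˡ-≤ M _ _ (≤-trans (≤-reflexive i≡) (subst (i ≤_) size i≤))) (inj₁ e≤k))
    where
    i≡ : M + (i ∸ M) ≡ i
    i≡ = m+[n∸m]≡n (<⇒≤ (≰⇒> i≰M))

-- The admissible positions of the interrupting letter in a column of length k + 1 + e:
-- the zigzag covers everything, or (k = e − 2) everything but a fixed point.
Admissible : Bool → ℕ → ℕ → Set
Admissible false k e = k ≤ e × e ≤ suc k
Admissible true  k e = e ≡ suc (suc k)

module _ {w : List ℕ} where

  -- Reachability in zero or more steps, for use until the cycle is known to return to 1.
  From1 : Pred ℕ 0ℓ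
  From1 i = i ≡ 1 ⊎ Reach w 1 i

  from1-step : ∀ {i v} → At w i v → From1 i → Reach w 1 v
  from1-step at (inj₁ refl) = [ at ]
  from1-step at (inj₂ p)    = p Closure.∷ʳ at

  from1-closed : ∀ {i v} → At w i v → From1 i → From1 v
  from1-closed at p = inj₂ (from1-step at p)

  close : Reach w 1 1 → ∀ {i} → From1 i → Reach w 1 i
  close p (inj₁ refl) = p
  close p (inj₂ r)    = r

-- The first run forms a column, `N` extends the first row, and the second run goes down the first
-- column. Without a first run, `N` itself would be bumped, so the second run has to be empty too.
column-with-max : ∀ {N} j m → 0 < m ⊎ j ≡ 0 → ∀ a → a + j + m < N →
  foldl ins [] (down (a + j) m ++ N ∷ down a j) ≡ glue (glue [] (down a j ʳ++ (down (a + j) m ʳ++ []))) (N ∷ [])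
column-with-max {N} j m nonempty a <N = begin
  foldl ins [] (down (a + j) m ++ N ∷ down a j)
    ≡⟨ foldl-++ ins [] (down (a + j) m) (N ∷ down a j) ⟩
  foldl ins (ins (foldl ins [] (down (a + j) m)) N) (down a j)
    ≡⟨ cong (λ t → foldl ins (ins t N) (down a j)) (fold-down {0} [] m [] [] z≤n []) ⟩
  foldl ins (ins (glue [] cs) N) (down a j)
    ≡⟨ cong (λ t → foldl ins t (down a j)) (glue-large (glue [] cs) [] bounded <N []) ⟩
  foldl ins (glue (glue [] cs) (N ∷ [])) (down a j)
    ≡⟨ rest m j nonempty refl refl ⟩
  glue (glue [] (down a j ʳ++ cs)) (N ∷ []) ∎
  where
  open ≡-Reasoning
  cs : List ℕ
  cs = down (a + j) m ʳ++ []

  bounded : Bounded (a + j + m) (glue [] cs)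
  bounded = column-bounded (All-ʳ++ (down (a + j) m) (All.map proj₂ (All-down (a + j) m ≤-refl)) [])

  rest : ∀ m′ j′ → 0 < m′ ⊎ j′ ≡ 0 → m′ ≡ m → j′ ≡ j →
    foldl ins (glue (glue [] cs) (N ∷ [])) (down a j) ≡ glue (glue [] (down a j ʳ++ cs)) (N ∷ [])
  rest _ _ (inj₂ refl) _ refl = refl
  rest (suc m′) _ (inj₁ _) refl refl with down-last (a + j) m′ []
  ... | ls , cs≡ = subst (λ xs → foldl ins (glue (glue [] xs) (N ∷ [])) (down a j) ≡ glue (glue [] (down a j ʳ++ xs)) (N ∷ []))
    (sym cs≡) (fold-column j ls (subst (Ascending (a + j)) cs≡ (ascending-down (suc m′) [])))

-- The zigzag through the first column of length d = m + 1 + j is continued by the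
-- zigzag through the second one, which ends in the letter 1.
twoColumns : ∀ b m j k e → m ≤ suc j → j ≤ m → Admissible b k (suc e) →
  Tower b (addColumn (suc k + suc e) (addColumn (m + suc j) []))
twoColumns b m j k e′ m≤ j≤m adm = tower n u v size
    (All-down (1 + j) m (≤-trans (≤-reflexive (shuffle₁ j m)) d≤n))
    (All.++⁺ (All-down 1 j (≤-trans (m≤n+m (suc j) m) d≤n))
      (All.++⁺ (All-down (d + e) k e+k) ((z<s , ≤-trans (s≤s z≤n) (≤-trans 0<d d≤n)) ∷ All-down d e (≤-trans (m≤m+n (d + e) k) e+k))))
    P-shape (cyclic (φ b) (subst (φ b ≤_) (sym size) (<⇒≤ (φ<n b adm))) (exception b adm) reach) (φ<n b adm)
  where
  e d n : ℕ
  e = suc e′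
  d = m + suc j
  n = d + (suc k + e)

  u v w : List ℕ
  u = down (1 + j) m
  v = down 1 j ++ block d k e 1
  w = u ++ n ∷ v

  shuffle₁ : ∀ j m → 1 + j + m ≡ m + suc j
  shuffle₁ = solve-∀

  d≤n : d ≤ n
  d≤n = m≤m+n d _

  0<d : 0 < d
  0<d = ≤-trans (s≤s z≤n) (m≤n+m (suc j) m)

  e+k : d + e + k ≤ n
  e+k = ≤-trans (≤-reflexive (trans (+-assoc d e k) (cong (d +_) (+-comm e k)))) (+-monoʳ-≤ d (n≤1+n (k + e)))

  -- The word is read as two interrupted runs: the letters from `d` down to 2 around `N`, then those
  -- from `n − 1` down to `d + 1` around 1.
  regroup : ∀ N → block 1 m j N ++ block d k e 1 ≡ u ++ N ∷ v
  regroup N = ++-assoc u (N ∷ down 1 j) (block d k e 1)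

  size : length w ≡ n
  size = trans (cong length (sym (regroup n))) (trans (length-++ (block 1 m j n))
    (cong₂ _+_ (length-block 1 m j n) (trans (length-block d k e 1) (+-suc k e))))

  k≤e : ∀ b → Admissible b k e → k ≤ e
  k≤e false (p , _) = p
  k≤e true  eq      = ≤-trans (m≤n+m k 2) (≤-reflexive (sym eq))

  cs : List ℕ
  cs = down 1 j ʳ++ (u ʳ++ [])

  cs≤d : All (_≤ d) cs
  cs≤d = All-ʳ++ (down 1 j) (All.map proj₂ (All-down 1 j (m≤n+m (suc j) m)))
    (All-ʳ++ u (All.map proj₂ (All-down (1 + j) m (≤-reflexive (shuffle₁ j m)))) [])

  P-shape : ∀ N → n ≤ N → ∃₂ λ r rs → P (u ++ N ∷ v) ≡ r ∷ rs × All (_< n) r × Γ (r ∷ rs) ≡ addColumn (suc k + e) (addColumn d [])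
  P-shape N n≤N with down-last d e′ (down (d + e) k ʳ++ (N ∷ []))
  ... | ls , col≡ with glue-top (glue [] (1 ∷ cs)) ls (column-bounded (0<d ∷ cs≤d)) (n≤1+n d)
  ...   | r , rs , top≡ , r≤ = r , rs , eq , All.map (λ p → ≤-<-trans p d+1<n) r≤ , (begin
      Γ (r ∷ rs)                                               ≡⟨ cong Γ (sym (trans (cong (glue (glue [] (1 ∷ cs))) col≡) top≡)) ⟩
      Γ (glue (glue [] (1 ∷ cs)) (blockColumn d k e (N ∷ []))) ≡⟨ Γ-glue (glue [] (1 ∷ cs)) (blockColumn d k e (N ∷ [])) ⟩
      addColumn (length (blockColumn d k e (N ∷ []))) (Γ (glue [] (1 ∷ cs)))
        ≡⟨ cong₂ addColumn (trans (length-blockColumn d k e (N ∷ [])) (shuffle₂ e k)) (trans (Γ-glue [] (1 ∷ cs)) (cong (λ c → addColumn c []) length-cs)) ⟩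
      addColumn (suc k + e) (addColumn d [])                   ∎)
    where
    open ≡-Reasoning
    shuffle₂ : ∀ e k → e + (k + 1) ≡ suc k + e
    shuffle₂ = solve-∀
    shuffle₃ : ∀ j m → suc (j + (m + 0)) ≡ m + suc j
    shuffle₃ = solve-∀
    shuffle₄ : ∀ d k e → suc (d + e + k) ≡ d + (suc k + e)
    shuffle₄ = solve-∀

    length-cs : suc (length cs) ≡ d
    length-cs = trans (cong suc (length-blockColumn 1 m j [])) (shuffle₃ j m)

    d+1<n : suc d < n
    d+1<n = ≤-trans (≤-reflexive (+-comm 2 d)) (+-monoʳ-≤ d (s≤s (≤-trans (s≤s z≤n) (m≤n+m e k))))

    nonempty : ∀ m → j ≤ m → 0 < m ⊎ j ≡ 0
    nonempty zero    j≤0 = inj₂ (n≤0⇒n≡0 j≤0)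
    nonempty (suc _) _   = inj₁ z<s

    <N : 1 + j + m < N
    <N = ≤-<-trans (≤-reflexive (shuffle₁ j m)) (<-≤-trans (<-trans (n<1+n d) d+1<n) n≤N)

    eq : P (u ++ N ∷ v) ≡ r ∷ rs
    eq = begin
      P (u ++ N ∷ v)                                                 ≡⟨ cong P (sym (regroup N)) ⟩
      P (block 1 m j N ++ block d k e 1)                             ≡⟨ foldl-++ ins [] (block 1 m j N) (block d k e 1) ⟩
      foldl ins (P (block 1 m j N)) (block d k e 1)                  ≡⟨ cong (λ t → foldl ins t (block d k e 1)) (column-with-max j m (nonempty m j≤m) 1 <N) ⟩
      foldl ins (glue (glue [] cs) (N ∷ [])) (block d k e 1)         ≡⟨ fold-block (glue [] cs) k e′ 1 (N ∷ []) (column-bounded cs≤d) 0<d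
                                                                          (≤-trans (≤-reflexive (shuffle₄ d k e)) n≤N ∷ []) ⟩
      glue (ins (glue [] cs) 1) (blockColumn d k e (N ∷ []))         ≡⟨ cong₂ glue (glue-large {0} [] cs [] z<s (ascending-down j (ascending-down m []))) col≡ ⟩
      glue (glue [] (1 ∷ cs)) (suc d ∷ ls)                           ≡⟨ top≡ ⟩
      r ∷ rs                                                         ∎

  -- The letter 1 is missing from the first block, whence the 1 for `δ`; this zigzag ends in `n`,
  -- where the second one takes over.
  module Left = Zigzag w 0 m j 1 n ≤-refl m≤ (λ {i} {x} p → subst (λ z → At z i x) (regroup n) (At-++ˡ p))
  module Right = Zigzag w d k e 0 1 z≤n (k≤e b adm) (λ {i} {x} p → subst₂ (λ z l → At z (l + i) x) (regroup n) (length-block 1 m j n) (At-++ʳ (block 1 m j n) p))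

  reach-n : From1 n
  reach-n = from1-closed Left.middle (Left.reach-lower From1 from1-closed (inj₁ refl) m ≤-refl)

  reach-d+1 : From1 (d + 1)
  reach-d+1 = from1-closed (Right.upper e 1 z<s ≤-refl (+-comm e 1)) reach-n

  reach-1 : Reach w 1 1
  reach-1 = from1-step Right.middle (Right.reach-lower From1 from1-closed reach-d+1 k ≤-refl)

  φ : Bool → ℕ
  φ false = 0
  -- For `e = k + 2`, position `k + 2` of the second block is its own mirror image.
  φ true  = d + suc (suc k)

  φ<n : ∀ b → Admissible b k e → φ b < n
  φ<n false _  = ≤-trans 0<d d≤n
  φ<n true  eq = ≤-trans (≤-reflexive (sym (+-suc d _))) (+-monoʳ-≤ d (s≤s (≤-trans (≤-reflexive (sym eq)) (m≤n+m e k))))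

  exception : ∀ b → Admissible b k e → Exception b (φ b) w
  exception false _  = refl
  exception true  eq = ≤-trans (s≤s (s≤s z≤n)) (m≤n+m (suc (suc k)) d) ,
    subst₂ (At w) (cong (d +_) (+-comm (suc k) 1)) (cong (d +_) eq) (Right.upper 1 e z<s (s≤s z≤n) refl)

  reach : ∀ i → InRange (length w) i → i ≢ φ b → Reach w 1 i
  reach i (0<i , i≤) i≢φ with i ≤? d
  ... | yes i≤d = close reach-1 (Left.cover From1 from1-closed (inj₁ refl) (λ ()) i 0<i (≤-trans i≤d (≤-reflexive (+-suc m j))) (inj₁ (s≤s j≤m)))
  ... | no i≰d = close reach-1 (subst From1 i≡ (Right.cover From1 from1-closed reach-d+1 (λ _ → reach-n) (i ∸ d)
      (m<n⇒0<n∸m (≰⇒> i≰d)) (+-cancelˡ-≤ d _ _ (≤-trans (≤-reflexive i≡) (subst (i ≤_) size i≤))) (misses b adm i≢φ)))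
    where
    i≡ : d + (i ∸ d) ≡ i
    i≡ = m+[n∸m]≡n (<⇒≤ (≰⇒> i≰d))

    misses : ∀ b → Admissible b k e → i ≢ φ b → e ≤ suc k ⊎ (e ≡ suc (suc k) × i ∸ d ≢ suc (suc k))
    misses false (_ , e≤) _   = inj₁ e≤
    misses true  eq       i≢φ = inj₂ (eq , λ i∸d≡ → i≢φ (trans (sym i≡) (cong (d +_) i∸d≡)))

-- One zigzag on 2m + 3 positions, with the largest letter interrupting the run and forming the
-- second column. The run after it is longer by two, so position `m + 2` is fixed. For `m = 0` the
-- word would be 321, of another shape.
hookWithFixedPoint : ∀ m → 0 < m → Word true (addColumn 1 (addColumn (suc (suc m) + m) []))
hookWithFixedPoint m 0<m = word w range shape (cyclic (suc (suc m)) (<⇒≤ φ<) ((s≤s (s≤s z≤n)) , fixed) reach)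
  where
  e n : ℕ
  e = suc (suc m)
  n = suc m + e

  w : List ℕ
  w = block 0 m e n

  size : length w ≡ n
  size = trans (length-block 0 m e n) (+-suc m e)

  range : All (InRange (length w)) w
  range rewrite size = All.++⁺ (All-down e m (≤-trans (≤-reflexive (+-comm e m)) (n≤1+n _))) ((z<s , ≤-refl) ∷ All-down 0 e (m≤n+m e (suc m)))

  cs : List ℕ
  cs = down 0 e ʳ++ (down e m ʳ++ [])

  shape : Γ (P w) ≡ addColumn 1 (addColumn (e + m) [])
  shape = trans (cong Γ (column-with-max e m (inj₁ 0<m) 0 (s≤s (≤-reflexive (+-comm e m)))))
    (trans (Γ-glue (glue [] cs) (n ∷ [])) (cong (addColumn 1) (trans (Γ-glue [] cs)
      (cong (λ c → addColumn c []) (trans (length-blockColumn 0 m e []) (cong (e +_) (+-identityʳ m)))))))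

  open Zigzag w 0 m e 0 n z≤n (m≤n+m m 2) id

  φ< : e < length w
  φ< = subst (e <_) (sym size) (s≤s (m≤n+m e m))

  fixed : At w e e
  fixed = subst (λ i → At w i e) (+-comm (suc m) 1) (upper 1 e z<s (s≤s z≤n) refl)

  reach-n : From1 n
  reach-n = from1-closed middle (reach-lower From1 from1-closed (inj₁ refl) m ≤-refl)

  reach : ∀ i → InRange (length w) i → i ≢ e → Reach w 1 i
  reach i (0<i , i≤) i≢e = close (from1-step (upper e 1 z<s ≤-refl (+-comm e 1)) reach-n)
    (cover From1 from1-closed (inj₁ refl) (λ _ → reach-n) i 0<i (subst (i ≤_) size i≤) (inj₂ (refl , i≢e)))

-- From cyclic words to permutations

cells-fold : ∀ w t → cells (foldl ins t w) ≡ length w + cells t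
cells-fold []      t = refl
cells-fold (a ∷ w) t = trans (cells-fold w (ins t a)) (trans (cong (length w +_) (cells-insert a t)) (+-suc (length w) (cells t)))

-- A chosen section is injective; missing a point, it would inject `Fin (suc n)` into `Fin n`. It is
-- therefore onto and a two-sided inverse.
surjection⇒permutation : ∀ {n} (g : Fin n → Fin n) → (∀ j → ∃ λ i → g i ≡ j) → ∃ λ (σ : Permutation′ n) → ∀ i → app σ i ≡ g i
surjection⇒permutation {zero}  g onto = permutation g g (λ ()) (λ ()) , λ _ → refl
surjection⇒permutation {suc n} g onto = permutation g h (proj₂ ∘ onto) left , λ _ → refl
  where
  h : Fin (suc n) → Fin (suc n)
  h = proj₁ ∘ onto

  h-injective : ∀ {i j} → h i ≡ h j → i ≡ j
  h-injective {i} {j} eq = trans (sym (proj₂ (onto i))) (trans (cong g eq) (proj₂ (onto j)))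

  left : ∀ i → h (g i) ≡ i
  left i with any? (λ j → h j Fin.≟ i)
  ... | yes (j , refl) = cong h (proj₂ (onto j))
  ... | no missed = contradiction
    (injective⇒≤ {f = λ j → punchOut {i = i} (λ eq → missed (j , sym eq))}
      (λ {j} {k} eq → h-injective (punchOut-injective (λ eq′ → missed (j , sym eq′)) (λ eq′ → missed (k , sym eq′)) eq)))
    1+n≰n

At-lookup : ∀ w (i : Fin (length w)) → At w (suc (toℕ i)) (lookup w i)
At-lookup (x ∷ w) zero    = here
At-lookup (x ∷ w) (suc i) = there (At-lookup w i)

At-index : ∀ {w i v} → At w i v → ∃ λ j → suc (toℕ j) ≡ i × lookup w j ≡ v
At-index here = zero , refl , refl
At-index (there p) with At-index p
... | j , eq , eq′ = suc j , cong suc eq , eq′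

last-step : ∀ {w i v} → Reach w i v → ∃ λ z → At w z v
last-step [ at ]  = _ , at
last-step (_ ∷ p) = last-step p

cycleType : Bool → ℕ → List ℕ
cycleType false n = n ∷ []
cycleType true  n = (n ∸ 1) ∷ 1 ∷ []

module Realise {m : ℕ} {b : Bool} (w : List ℕ) (size : length w ≡ suc m) (range : All (InRange (length w)) w) (c : Cyclic b w) where
  open Cyclic c

  letterAt : Fin (length w) → Fin (length w)
  letterAt i = fromℕ< (pred-bound (All.lookup range (∈-lookup i)))
    where
    pred-bound : ∀ {x n} → InRange n x → x ∸ 1 < n
    pred-bound {suc x} (_ , le) = le

  letterAt≡ : ∀ i → suc (toℕ (letterAt i)) ≡ lookup w i
  letterAt≡ i = trans (cong suc (toℕ-fromℕ< _)) (suc-pred′ (proj₁ (All.lookup range (∈-lookup i))))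
    where
    suc-pred′ : ∀ {x} → 0 < x → suc (x ∸ 1) ≡ x
    suc-pred′ {suc x} _ = refl

  At-letter : ∀ {i z} → At w (suc (toℕ i)) z → z ≡ suc (toℕ (letterAt i))
  At-letter {i} at = trans (At-functional at (At-lookup w i)) (sym (letterAt≡ i))

  preimage : ∀ {z j} → At w z (suc (toℕ j)) → ∃ λ i → letterAt i ≡ j
  preimage at with At-index at
  ... | i , _ , eq = i , toℕ-injective (suc-injective (trans (letterAt≡ i) eq))

  fixed-at : ∀ b → Exception b φ w → ∀ (j : Fin (length w)) → suc (toℕ j) ≡ φ → At w (suc (toℕ j)) (suc (toℕ j))
  fixed-at false refl     j ()
  fixed-at true  (_ , at) j refl = at

  -- The last step of a path to a position starts at a place holding that letter; the exceptional
  -- position is its own preimage.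
  onto : ∀ j → ∃ λ i → letterAt i ≡ j
  onto j with suc (toℕ j) ≟ φ
  ... | yes eq = preimage (fixed-at b exception j eq)
  ... | no ≢φ  = preimage (proj₂ (last-step (reach (suc (toℕ j)) (z<s , toℕ<n j) ≢φ)))

  σ : Permutation′ (length w)
  σ = proj₁ (surjection⇒permutation letterAt onto)

  app≡ : ∀ i → app σ i ≡ letterAt i
  app≡ = proj₂ (surjection⇒permutation letterAt onto)

  oneLine≡ : oneLine σ ≡ w
  oneLine≡ = begin
    map (λ i → suc (toℕ (app σ i))) (allFin (length w))   ≡⟨ map-tabulate id (λ i → suc (toℕ (app σ i))) ⟩
    tabulate (λ i → suc (toℕ (app σ i)))                  ≡⟨ tabulate-cong (λ i → trans (cong (suc ∘ toℕ) (app≡ i)) (letterAt≡ i)) ⟩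
    tabulate (lookup w)                                   ≡⟨ tabulate-lookup w ⟩
    w                                                     ∎
    where open ≡-Reasoning

  reach⇒iter : ∀ {x y z} → Reach w z (suc (toℕ y)) → z ≡ suc (toℕ x) → ∃ λ k → iter σ k x ≡ y
  reach⇒iter {x} [ at ]     refl = 1 , trans (app≡ x) (toℕ-injective (suc-injective (sym (At-letter {x} at))))
  reach⇒iter {x} (at ∷ p) refl with reach⇒iter {app σ x} p (trans (At-letter {x} at) (cong (suc ∘ toℕ) (sym (app≡ x))))
  ... | k , eq = suc k , eq

hasCycleType : ∀ {m} b (w : List ℕ) → length w ≡ suc m → All (InRange (length w)) w → Cyclic b w →
  ∃ λ (σ : Permutation′ (length w)) → oneLine σ ≡ w × HasCycleType σ (cycleType b (length w))
hasCycleType false w@(_ ∷ _) size range c@(cyclic φ _ refl reach) = σ , oneLine≡ ,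
    transitive⇒cycleType σ λ i → reach⇒iter (reach (suc (toℕ i)) (z<s , toℕ<n i) λ ()) refl
  where open Realise w size range c
hasCycleType true w@(_ ∷ _) size range c@(cyclic (suc φ) φ≤ (1<φ , at) reach) = σ , oneLine≡ ,
    transitive-but-one⇒cycleType σ φ′
      (trans (app≡ φ′) (toℕ-injective (suc-injective (trans (sym (At-letter (subst (λ i → At w i (suc φ)) (sym φ≡) at))) (sym φ≡)))))
      (λ φ≡0 → <-irrefl (sym (trans (sym φ≡) (cong (suc ∘ toℕ) φ≡0))) 1<φ)
      (λ i i≢ → reach⇒iter (reach (suc (toℕ i)) (z<s , toℕ<n i) λ eq → i≢ (toℕ-injective (suc-injective (trans eq (sym φ≡))))) refl)
  where
  open Realise w size range c
  φ′ : Fin (length w)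
  φ′ = fromℕ< φ≤
  φ≡ : suc (toℕ φ′) ≡ suc φ
  φ≡ = cong suc (toℕ-fromℕ< φ≤)

realise : ∀ {b shape n} → 0 < n → sum shape ≡ n → Word b shape →
  ∃ λ (σ : Permutation′ n) → HasCycleType σ (cycleType b n) × Γ (P (oneLine σ)) ≡ shape
realise {b} {shape} {suc _} _ sum≡ (word w range Γ≡ c) =
  let σ , line , type = hasCycleType b w size range c in
  subst (λ n → ∃ λ (σ : Permutation′ n) → HasCycleType σ (cycleType b n) × Γ (P (oneLine σ)) ≡ shape) size
    (σ , type , trans (cong (Γ ∘ P) line) Γ≡)
  where
  size : length w ≡ _
  size = trans (sym (trans (cells-fold w []) (+-identityʳ (length w)))) (trans (cong sum Γ≡) sum≡)

-- Partitions as sums of columns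

columnShape : List ℕ → List ℕ
columnShape = foldr addColumn []

addColumn-comm : ∀ c d rs → addColumn c (addColumn d rs) ≡ addColumn d (addColumn c rs)
addColumn-comm zero    d       rs       = refl
addColumn-comm (suc c) zero    rs       = refl
addColumn-comm (suc c) (suc d) []       = cong (2 ∷_) (addColumn-comm c d [])
addColumn-comm (suc c) (suc d) (r ∷ rs) = cong (suc (suc r) ∷_) (addColumn-comm c d rs)

-- Columns may be listed in any order, which lets the construction add them in the order that suits
-- it.
columnShape-↭ : ∀ {cs ds} → cs ↭ ds → columnShape cs ≡ columnShape ds
columnShape-↭ Perm.refl = refl
columnShape-↭ (Perm.prep c p) = cong (addColumn c) (columnShape-↭ p)
columnShape-↭ (Perm.swap {ys = ys} c d p) =
  trans (cong (addColumn c ∘ addColumn d) (columnShape-↭ p)) (addColumn-comm c d (columnShape ys))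
columnShape-↭ (Perm.trans p q) = trans (columnShape-↭ p) (columnShape-↭ q)

sum-addColumn : ∀ c rs → sum (addColumn c rs) ≡ c + sum rs
sum-addColumn zero    rs       = refl
sum-addColumn (suc c) []       = cong suc (sum-addColumn c [])
sum-addColumn (suc c) (r ∷ rs) = cong suc (trans (cong (r +_) (sum-addColumn c rs)) (shuffle r c (sum rs)))
  where
  shuffle : ∀ r c s → r + (c + s) ≡ c + (r + s)
  shuffle = solve-∀

sum-columnShape : ∀ cs → sum (columnShape cs) ≡ sum cs
sum-columnShape []       = refl
sum-columnShape (c ∷ cs) = trans (sum-addColumn c (columnShape cs)) (cong (c +_) (sum-columnShape cs))

columnShape-map-suc : ∀ cs k → 0 < length cs + k → columnShape (map suc cs ++ replicate k 1) ≡ (length cs + k) ∷ columnShape cs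
columnShape-map-suc []           (suc zero)    _ = refl
columnShape-map-suc []           (suc (suc k)) _ = cong (addColumn 1) (columnShape-map-suc [] (suc k) z<s)
columnShape-map-suc (c ∷ [])     zero          _ = refl
columnShape-map-suc (c ∷ d ∷ cs) k             _ = cong (addColumn (suc c)) (columnShape-map-suc (d ∷ cs) k z<s)
columnShape-map-suc (c ∷ [])     (suc k)       _ = cong (addColumn (suc c)) (columnShape-map-suc [] (suc k) z<s)

-- The conjugate partition: a new top row lengthens every column by one and adds columns of length
-- 1.
columns : List ℕ → List ℕ
columns []       = []
columns (r ∷ rs) = map suc (columns rs) ++ replicate (r ∸ length (columns rs)) 1

length-columns : ∀ r rs → Linked _≥_ (r ∷ rs) → length (columns (r ∷ rs)) ≡ r × length (columns rs) ≤ r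
length-columns r rs linked = trans (length-++ (map suc (columns rs)))
    (trans (cong₂ _+_ (length-map suc (columns rs)) (length-replicate _)) (m+[n∸m]≡n (bound rs linked))) , bound rs linked
  where
  bound : ∀ rs → Linked _≥_ (r ∷ rs) → length (columns rs) ≤ r
  bound []       _             = z≤n
  bound (s ∷ rs) (s≤r ∷ linked) = subst (_≤ r) (sym (proj₁ (length-columns s rs linked))) s≤r

columnShape-columns : ∀ rs → Linked _≥_ rs → All (0 <_) rs → columnShape (columns rs) ≡ rs
columnShape-columns []       _      _          = refl
columnShape-columns (r ∷ rs) linked (0<r ∷ ps) = trans
  (columnShape-map-suc (columns rs) _ (subst (0 <_) (sym size) 0<r))
  (cong₂ _∷_ size (columnShape-columns rs (Linked-tail linked) ps))
  where
  size : length (columns rs) + (r ∸ length (columns rs)) ≡ r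
  size = m+[n∸m]≡n (proj₂ (length-columns r rs linked))

columns-positive : ∀ rs → All (0 <_) (columns rs)
columns-positive []       = []
columns-positive (r ∷ rs) = All.++⁺ (All.map⁺ (All.universal (λ _ → z<s) (columns rs))) (All.replicate⁺ (r ∸ length (columns rs)) z<s)

Short : List ℕ → ℕ → Set
Short cs a = cs ≡ [] × a ≡ 0

-- Columns of length at least 2 are separated from the `a` columns of length 1. The first kind is
-- absent only from a single row, and `Short` describes a single column.
columns-decomposition : ∀ {n rs} → IsPartition n rs → rs ≢ n ∷ [] → rs ≢ replicate n 1 →
  ∃ λ c → ∃₂ λ cs a → columnShape (suc c ∷ map suc cs ++ replicate a 1) ≡ rs × All (0 <_) (c ∷ cs) × ¬ Short cs a
columns-decomposition {n} {[]} (_ , _ , refl) _ ≢col = contradiction refl ≢col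
columns-decomposition {n} {r ∷ rs} (linked , positive , total) ≢row ≢col
  with columns rs | r ∸ length (columns rs) | columnShape-columns (r ∷ rs) linked positive | columns-positive rs
     | columnShape-columns rs (Linked-tail linked) (All.tail positive)
... | []     | a | _     | _   | refl = contradiction (cong (_∷ []) (trans (sym (+-identityʳ r)) total)) ≢row
... | c ∷ cs | a | shape | pos | _    = c , cs , a , shape , pos , λ { (refl , refl) → ≢col (single shape) }
  where
  column : ∀ c → addColumn c [] ≡ replicate c 1
  column zero    = refl
  column (suc c) = cong (1 ∷_) (column c)

  single : columnShape (suc c ∷ []) ≡ r ∷ rs → r ∷ rs ≡ replicate n 1
  single eq = trans (sym eq) (trans (column (suc c))
    (cong (λ k → replicate k 1) (trans (sym (+-identityʳ (suc c))) (trans (sym (sum-columnShape (suc c ∷ []))) (trans (cong sum eq) total)))))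

-- Parity and the splitting of column lengths

odd : ℕ → Bool
odd zero    = false
odd (suc n) = not (odd n)

%2≡1⇒odd : ∀ n → n % 2 ≡ 1 → odd n ≡ true
%2≡1⇒odd (suc zero)    _  = refl
%2≡1⇒odd (suc (suc n)) eq = trans (not-involutive (odd n)) (%2≡1⇒odd n eq)

odd-+ : ∀ m n → odd (m + n) ≡ odd m xor odd n
odd-+ zero    n = refl
odd-+ (suc m) n rewrite odd-+ m n with odd m
... | true  = not-involutive (odd n)
... | false = refl

odd-member : ∀ cs → odd (sum cs) ≡ true → ∃₂ λ c ds → cs ↭ c ∷ ds × odd c ≡ true
odd-member (c ∷ cs) eq with odd c in odd-c | trans (sym (odd-+ c (sum cs))) eq
... | true  | _   = c , cs , Perm.refl , odd-c
... | false | eq′ with odd-member cs eq′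
...   | d , ds , p , odd-d = d , c ∷ ds , Perm.trans (Perm.prep c p) (Perm.swap c d Perm.refl) , odd-d

-- The summands count the new letters before and after the interrupting letter; nearly equal halves
-- give a full zigzag.
split-long : ∀ c → 2 ≤ c → ∃₂ λ k e → k ≤ suc e × suc e ≤ suc k × suc k + suc e ≡ c
split-long (suc zero)                (s≤s ())
split-long (suc (suc zero))          _ = 0 , 0 , z≤n , ≤-refl , refl
split-long (suc (suc (suc zero)))    _ = 1 , 0 , ≤-refl , s≤s z≤n , refl
split-long (suc (suc (suc (suc c)))) _ with split-long (suc (suc c)) (s≤s (s≤s z≤n))
... | k , e , p , q , eq = suc k , suc e , s≤s p , s≤s q , cong suc (trans (+-suc (suc k) (suc e)) (cong suc eq))

split-any : ∀ d → 0 < d → ∃₂ λ m j → m ≤ suc j × j ≤ m × m + suc j ≡ d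
split-any (suc zero)          _ = 0 , 0 , z≤n , z≤n , refl
split-any (suc (suc zero))    _ = 1 , 0 , ≤-refl , z≤n , refl
split-any (suc (suc (suc d))) _ with split-any (suc d) z<s
... | m , j , p , q , eq = suc m , suc j , s≤s p , s≤s q , cong suc (trans (+-suc m (suc j)) (cong suc eq))

split-odd : ∀ c → 2 ≤ c → odd c ≡ true → ∃ λ k → suc k + suc (suc k) ≡ c
split-odd (suc zero)                      (s≤s ()) _
split-odd (suc (suc (suc zero)))          _ _ = 0 , refl
split-odd (suc (suc (suc (suc c))))       _ eq
  with split-odd (suc (suc c)) (s≤s (s≤s z≤n)) (trans (sym (not-involutive (odd (suc (suc c))))) eq)
... | k , eq′ = suc k , cong suc (trans (+-suc (suc k) (suc (suc k))) (cong suc eq′))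

split-even : ∀ d → 4 ≤ d → odd d ≡ false → ∃ λ m → 0 < m × suc (suc m) + m ≡ d
split-even (suc (suc (suc (suc zero)))) _ _ = 1 , z<s , refl
split-even (suc (suc (suc (suc (suc zero))))) _ ()
split-even (suc (suc (suc (suc (suc (suc d)))))) _ eq
  with split-even (suc (suc (suc (suc d)))) (s≤s (s≤s (s≤s (s≤s z≤n)))) (trans (sym (not-involutive (odd (suc (suc (suc (suc d))))))) eq)
... | m , _ , eq′ = suc m , z<s , cong suc (trans (+-suc (suc (suc m)) m) (cong suc eq′))
split-even (suc (suc (suc zero))) (s≤s (s≤s (s≤s ()))) _
split-even (suc (suc zero)) (s≤s (s≤s ())) _
split-even (suc zero) (s≤s ()) _

-- Cyclic words of every shape

twoColumns-full : ∀ d c → 0 < d → 2 ≤ c → Tower false (columnShape (c ∷ d ∷ []))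
twoColumns-full d c 0<d 2≤c with split-any d 0<d | split-long c 2≤c
... | m , j , m≤ , j≤ , refl | k , e , k≤ , e≤ , refl = twoColumns false m j k e m≤ j≤ (k≤ , e≤)

twoColumns-fixed : ∀ d c → 0 < d → 2 ≤ c → odd c ≡ true → Tower true (columnShape (c ∷ d ∷ []))
twoColumns-fixed d c 0<d 2≤c odd-c with split-any d 0<d | split-odd c 2≤c odd-c
... | m , j , m≤ , j≤ , refl | k , refl = twoColumns true m j k (suc k) m≤ j≤ refl

addLongColumns : ∀ {b} ds {cs} → All (2 ≤_) cs → Tower b (columnShape ds) → Tower b (columnShape (cs ++ ds))
addLongColumns ds []         t = t
addLongColumns ds (2≤c ∷ ps) t with split-long _ 2≤c | addLongColumns ds ps t
... | k , e , k≤ , e≤ , refl | t′@(tower _ _ _ size _ _ _ (cyclic φ _ _ _) φ<n) =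
  addLongColumn k e k≤ e≤ (toWord t′) (subst (φ <_) (sym size) φ<n)

addOnes : ∀ {b} ds a → Tower b (columnShape ds) → Tower b (columnShape (replicate a 1 ++ ds))
addOnes ds zero    t = t
addOnes ds (suc a) t = addOne (addOnes ds a t)

long-columns : ∀ {cs} → All (0 <_) cs → All (2 ≤_) (map suc cs)
long-columns ps = All.map⁺ (All.map s≤s ps)

-- The second column of the starting word has length at least 2. If columns of length 1 occur, one
-- of them becomes the first column, and the others are added last.
fullWord : ∀ c cs a → All (0 <_) (c ∷ cs) → ¬ Short cs a → Word false (columnShape (suc c ∷ map suc cs ++ replicate a 1))
fullWord c []       zero    _                ¬short = contradiction (refl , refl) ¬short
fullWord c (d ∷ cs) zero    (0<c ∷ _ ∷ ps)   _ = subst (Word false) (columnShape-↭ perm)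
  (toWord (addLongColumns (suc c ∷ suc d ∷ []) (long-columns ps) (twoColumns-full (suc d) (suc c) z<s (s≤s 0<c))))
  where
  perm : map suc cs ++ suc c ∷ suc d ∷ [] ↭ suc c ∷ suc d ∷ map suc cs ++ []
  perm = ↭-trans (++-comm (map suc cs) (suc c ∷ suc d ∷ [])) (↭-reflexive (cong (λ xs → suc c ∷ suc d ∷ xs) (sym (++-identityʳ (map suc cs)))))
fullWord c cs       (suc a) (0<c ∷ ps)       _ = subst (Word false) (columnShape-↭ perm)
  (toWord (addOnes _ a (addLongColumns (suc c ∷ 1 ∷ []) (long-columns ps) (twoColumns-full 1 (suc c) z<s (s≤s 0<c)))))
  where
  perm : replicate a 1 ++ map suc cs ++ suc c ∷ 1 ∷ [] ↭ suc c ∷ map suc cs ++ 1 ∷ replicate a 1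
  perm = ↭-trans (++-comm (replicate a 1) (map suc cs ++ suc c ∷ 1 ∷ []))
    (↭-trans (↭-reflexive (++-assoc (map suc cs) (suc c ∷ 1 ∷ []) (replicate a 1))) (shift (suc c) (map suc cs) (1 ∷ replicate a 1)))

appendFixed : ∀ {r rs} → Word false (r ∷ rs) → Word true (suc r ∷ rs)
appendFixed {r} {rs} (word w range Γ≡ (cyclic φ _ refl reach)) = word w′
  (subst (λ n → All (InRange n) w′) (sym size) (All.++⁺ (All.map (range-weaken (n≤1+n (length w))) range) ((z<s , ≤-refl) ∷ [])))
  (shape′ (P w) refl) (cyclic N (≤-reflexive (sym size)) (s≤s (w≢[] w Γ≡) , At-middle w) reach′)
  where
  N : ℕ
  N = suc (length w)

  w′ : List ℕ
  w′ = w ++ N ∷ []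

  size : length w′ ≡ N
  size = trans (length-++ w) (+-comm _ 1)

  w≢[] : ∀ w → Γ (P w) ≡ r ∷ rs → 0 < length w
  w≢[] (_ ∷ _) _ = z<s

  shape′ : ∀ t → P w ≡ t → Γ (P w′) ≡ suc r ∷ rs
  shape′ [] eq = contradiction (trans (sym Γ≡) (cong Γ eq)) λ ()
  shape′ (r₁ ∷ t) eq = begin
    Γ (P w′)                          ≡⟨ cong Γ (foldl-++ ins [] w (N ∷ [])) ⟩
    Γ (ins (P w) N)                   ≡⟨ cong (λ t → Γ (ins t N)) eq ⟩
    Γ (ins (r₁ ∷ t) N)                ≡⟨ cong Γ (insert-append (large-append bounded)) ⟩
    length (r₁ ++ N ∷ []) ∷ Γ t       ≡⟨ cong (_∷ Γ t) (trans (length-++ r₁) (+-comm _ 1)) ⟩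
    suc (length r₁) ∷ Γ t             ≡⟨ cong (addColumn 1) (trans (cong Γ (sym eq)) Γ≡) ⟩
    suc r ∷ rs                        ∎
    where
    open ≡-Reasoning
    bounded : All (_≤ N) r₁
    bounded = All.head (subst (All (All (_≤ N))) eq (All-fold w (All.map (λ p → m≤n⇒m≤1+n (proj₂ p)) range) []))

  reach′ : ∀ i → InRange (length w′) i → i ≢ N → Reach w′ 1 i
  reach′ i (0<i , i≤) i≢N = reach-map (λ at → [ At-++ˡ at ])
    (reach i (0<i , ≤-pred (≤∧≢⇒< (subst (i ≤_) size i≤) i≢N)) (>⇒≢ 0<i))

transposition : Word false (1 ∷ 1 ∷ [])
transposition = word (2 ∷ 1 ∷ []) ((z<s , ≤-refl) ∷ (z<s , s≤s z≤n) ∷ []) refl (cyclic 0 z≤n refl reach)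
  where
  reach : ∀ i → InRange 2 i → i ≢ 0 → Reach (2 ∷ 1 ∷ []) 1 i
  reach zero                (() , _)             _
  reach (suc zero)          _                    _ = here ∷ [ there here ]
  reach (suc (suc zero))    _                    _ = [ here ]
  reach (suc (suc (suc i))) (_ , s≤s (s≤s ()))   _

-- Without columns of length 1, some column has odd length, as `n` is odd, and it carries the fixed
-- point. Otherwise a cell is removed from the first row, the rest is realised by a full cycle and a
-- fixed point is appended. If the rest is a single column, this works only for the shape (2, 1),
-- and `hookWithFixedPoint` serves the longer ones.
fixedWord : ∀ c cs a → All (0 <_) (c ∷ cs) → ¬ Short cs a → odd (sum (suc c ∷ map suc cs ++ replicate a 1)) ≡ true →
  Word true (columnShape (suc c ∷ map suc cs ++ replicate a 1))
fixedWord c [] zero _ ¬short _ = contradiction (refl , refl) ¬short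
fixedWord c (d ∷ cs) zero ps _ odd-n with odd-member (map suc (c ∷ d ∷ cs) ++ []) odd-n
... | x , [] , perm , _ = contradiction (↭-length perm) λ ()
... | x , y ∷ ds , perm , odd-x with All-resp-↭ perm (All.++⁺ (long-columns ps) [])
...   | 2≤x ∷ 2≤y ∷ 2≤ds = subst (Word true) (columnShape-↭ (↭-trans (++-comm ds (x ∷ y ∷ [])) (↭-sym perm)))
  (toWord (addLongColumns (x ∷ y ∷ []) 2≤ds (twoColumns-fixed y x (<⇒≤ 2≤y) 2≤x odd-x)))
fixedWord (suc zero) [] (suc zero) _ _ _ = appendFixed transposition
fixedWord (suc (suc zero)) [] (suc zero) _ _ ()
fixedWord (suc (suc (suc c))) [] (suc zero) _ _ odd-n
  with split-even (suc (suc (suc (suc c)))) (s≤s (s≤s (s≤s (s≤s z≤n)))) (even (odd-+ (suc (suc (suc (suc c)))) 1))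
  where
  even : odd (suc (suc (suc (suc c))) + 1) ≡ odd (suc (suc (suc (suc c)))) xor true → odd (suc (suc (suc (suc c)))) ≡ false
  even eq with odd (suc (suc (suc (suc c)))) | trans (sym eq) odd-n
  ... | false | _ = refl
... | m , 0<m , eq = subst (Word true) (trans (addColumn-comm 1 (suc (suc m) + m) []) (cong (λ d → columnShape (d ∷ 1 ∷ [])) eq)) (hookWithFixedPoint m 0<m)
fixedWord c [] (suc (suc a)) ps _ _ = subst (Word true) (sym (columnShape-map-suc (c ∷ []) (suc (suc a)) z<s))
  (appendFixed (subst (Word false) (columnShape-map-suc (c ∷ []) (suc a) z<s) (fullWord c [] (suc a) ps λ ())))
fixedWord c (d ∷ cs) (suc a) ps _ _ = subst (Word true)
  (sym (trans (columnShape-map-suc (c ∷ d ∷ cs) (suc a) z<s) (cong (_∷ columnShape (c ∷ d ∷ cs)) (+-suc (length (c ∷ d ∷ cs)) a))))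
  (appendFixed (subst (Word false) (columnShape-map-suc (c ∷ d ∷ cs) a z<s) (fullWord c (d ∷ cs) a ps λ ())))

-- The equivalence

cycleType⇒complete : ∀ {n} → 3 ≤ n → ∀ b → (b ≡ true → n % 2 ≡ 1) → RSKComplete n (cycleType b n)
cycleType⇒complete {n} 3≤n b parity rs partition ≢row ≢col with columns-decomposition partition ≢row ≢col
... | c , cs , a , refl , ps , ¬short = realise (≤-trans (s≤s z≤n) 3≤n) total (theWord b parity)
  where
  total : sum (columnShape (suc c ∷ map suc cs ++ replicate a 1)) ≡ n
  total = proj₂ (proj₂ partition)

  theWord : ∀ b → (b ≡ true → n % 2 ≡ 1) → Word b (columnShape (suc c ∷ map suc cs ++ replicate a 1))
  theWord false _      = fullWord c cs a ps ¬short
  theWord true  parity = fixedWord c cs a ps ¬short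
    (trans (cong odd (trans (sym (sum-columnShape (suc c ∷ map suc cs ++ replicate a 1))) total)) (%2≡1⇒odd n (parity refl)))

theorem5p1 : (n : ℕ) → 3 ≤ n → (μ : List ℕ) → IsPartition n μ →
    (RSKComplete n μ ⇔
    (μ ≡ n ∷ [] ⊎ (n % 2 ≡ 1 × μ ≡ (n ∸ 1) ∷ 1 ∷ [])))
theorem5p1 n 3≤n μ partition = mk⇔ (complete⇒cycleType 3≤n partition) λ
  { (inj₁ refl)         → cycleType⇒complete 3≤n false λ ()
  ; (inj₂ (odd , refl)) → cycleType⇒complete 3≤n true λ _ → odd }
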